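{- For every integer $k\ge 0$, $$-\frac{\pi}{2}=\arctan\left(\frac{L_{2k+1}}{2}\right)-2\arctan\left(\phi^{2k+1}\right).$$
   Context: $\phi=\frac{1+\sqrt5}{2}$ is the Golden mean. $(L_m)_{m\ge0}$ is the sequence of Lucas numbers: $L_0=2$, $L_1=1$, $L_m=L_{m-1}+L_{m-2}$ for $m\ge2$. -}

module Defs where

open import Data.Nat as ℕ using (ℕ; zero; suc)
import Data.Nat.Properties as ℕₚ
import Data.Nat.Solver as ℕ-Solver
open import Data.Integer using (+_)
import Data.Integer as ℤ
import Data.Integer.Properties as ℤₚ
open import Data.Rational hiding (_≃_)
open import Data.Rational.Properties
import Data.Rational.Unnormalised as ℚᵘ
import Data.Rational.Unnormalised.Properties as ℚᵘₚ
open import Data.Rational.Solver using (module +-*-Solver)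
open +-*-Solver using (solve; _:+_; _:*_; _:-_; :-_; _:=_; con)
open import Data.Product using (∃; _×_; _,_)
open import Data.Sum using (inj₁; inj₂)
open import Relation.Binary.PropositionalEquality
open import Relation.Nullary using (yes; no)

ι : ℕ → ℚ
ι n = + n / 1

opaque
  /≃ : ∀ i n → toℚᵘ (i / suc n) ℚᵘ.≃ ℚᵘ.mkℚᵘ i n
  /≃ i n = toℚᵘ-fromℚᵘ (ℚᵘ.mkℚᵘ i n)

  frac : ∀ a n → + a / suc n ≡ ι a * (+ 1 / suc n)
  frac a n = toℚᵘ-injective (ℚᵘₚ.≃-trans (/≃ (+ a) n) (ℚᵘₚ.≃-sym
    (ℚᵘₚ.≃-trans (toℚᵘ-homo-* (ι a) (+ 1 / suc n))
      (ℚᵘₚ.≃-trans (ℚᵘₚ.*-cong (/≃ (+ a) 0) (/≃ (+ 1) n))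
        (ℚᵘ.*≡* (cong₂ ℤ._*_ (ℤₚ.*-identityʳ (+ a)) (cong (λ z → + (suc z)) (sym (ℕₚ.+-identityʳ n)))))))))

  ι-+ : ∀ a b → ι (a ℕ.+ b) ≡ ι a + ι b
  ι-+ a b = toℚᵘ-injective (ℚᵘₚ.≃-trans (/≃ (+ (a ℕ.+ b)) 0) (ℚᵘₚ.≃-sym
    (ℚᵘₚ.≃-trans (toℚᵘ-homo-+ (ι a) (ι b))
      (ℚᵘₚ.≃-trans (ℚᵘₚ.+-cong (/≃ (+ a) 0) (/≃ (+ b) 0))
        (ℚᵘ.*≡* (cong (ℤ._* + 1) (cong₂ ℤ._+_ (ℤₚ.*-identityʳ (+ a)) (ℤₚ.*-identityʳ (+ b)))))))))

  ι-* : ∀ a b → ι (a ℕ.* b) ≡ ι a * ι b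
  ι-* a b = toℚᵘ-injective (ℚᵘₚ.≃-trans (/≃ (+ (a ℕ.* b)) 0) (ℚᵘₚ.≃-sym
    (ℚᵘₚ.≃-trans (toℚᵘ-homo-* (ι a) (ι b))
      (ℚᵘₚ.≃-trans (ℚᵘₚ.*-cong (/≃ (+ a) 0) (/≃ (+ b) 0))
        (ℚᵘ.*≡* (cong (ℤ._* + 1) (sym (ℤₚ.pos-* a b))))))))

  ι*recip : ∀ n → ι (suc n) * (+ 1 / suc n) ≡ 1ℚ
  ι*recip n = trans (sym (frac (suc n) n)) (toℚᵘ-injective (ℚᵘₚ.≃-trans (/≃ (+ suc n) n)
    (ℚᵘ.*≡* (trans (ℤₚ.*-identityʳ (+ suc n)) (sym (ℤₚ.*-identityˡ (+ suc n)))))))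

  ι-mono-≤ : ∀ {a b} → a ℕ.≤ b → ι a ≤ ι b
  ι-mono-≤ {a} {b} a≤b = toℚᵘ-cancel-≤ (ℚᵘₚ.≤-respˡ-≃ (ℚᵘₚ.≃-sym (/≃ (+ a) 0)) (ℚᵘₚ.≤-respʳ-≃ (ℚᵘₚ.≃-sym (/≃ (+ b) 0))
    (ℚᵘ.*≤* (ℤₚ.*-monoʳ-≤-nonNeg (+ 1) (ℤ.+≤+ a≤b)))))

  0≤ι : ∀ a → 0ℚ ≤ ι a
  0≤ι a = ι-mono-≤ {0} {a} ℕ.z≤n

  recip>0 : ∀ n → 0ℚ < + 1 / suc n
  recip>0 n = positive⁻¹ (+ 1 / suc n) {{normalize-pos 1 (suc n)}}

  recip≥0 : ∀ n → 0ℚ ≤ + 1 / suc n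
  recip≥0 n = <⇒≤ (recip>0 n)

  0≤⇒≤ : ∀ {p q} → 0ℚ ≤ q - p → p ≤ q
  0≤⇒≤ {p} {q} h = subst₂ _≤_ (+-identityʳ p) (solve 2 (λ p q → p :+ (q :- p) := q) refl p q) (+-monoʳ-≤ p h)

  ≤⇒0≤ : ∀ {p q} → p ≤ q → 0ℚ ≤ q - p
  ≤⇒0≤ {p} {q} h = subst (_≤ q - p) (+-inverseʳ p) (+-monoˡ-≤ (- p) h)

  0≤* : ∀ {p q} → 0ℚ ≤ p → 0ℚ ≤ q → 0ℚ ≤ p * q
  0≤* {p} {q} h k = subst (_≤ p * q) (*-zeroʳ p) (*-monoˡ-≤-nonNeg p {{nonNegative h}} k)

  0≤+ : ∀ {p q} → 0ℚ ≤ p → 0ℚ ≤ q → 0ℚ ≤ p + q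
  0≤+ h k = +-mono-≤ h k

  0<* : ∀ {p q} → 0ℚ < p → 0ℚ < q → 0ℚ < p * q
  0<* {p} {q} h k = positive⁻¹ (p * q) {{pos*pos⇒pos p {{positive h}} q {{positive k}}}}

  *-monoˡ : ∀ {p q} r → 0ℚ ≤ r → p ≤ q → r * p ≤ r * q
  *-monoˡ r h = *-monoˡ-≤-nonNeg r {{nonNegative h}}

  *-monoʳ : ∀ {p q} r → 0ℚ ≤ r → p ≤ q → p * r ≤ q * r
  *-monoʳ r h = *-monoʳ-≤-nonNeg r {{nonNegative h}}

  *-mono : ∀ {p q r s} → 0ℚ ≤ r → 0ℚ ≤ q → p ≤ q → r ≤ s → p * r ≤ q * s
  *-mono {p} {q} {r} {s} h k a b = ≤-trans (*-monoʳ r h a) (*-monoˡ q k b)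

  0≤sq : ∀ p → 0ℚ ≤ p * p
  0≤sq p with ∣p∣≡p∨∣p∣≡-p p
  ... | inj₁ e = 0≤* {p} {p} (∣p∣≡p⇒0≤p e) (∣p∣≡p⇒0≤p e)
  ... | inj₂ e = subst (0ℚ ≤_) (solve 1 (λ p → (:- p) :* (:- p) := p :* p) refl p) (0≤* { - p} h h)
    where
    h : 0ℚ ≤ - p
    h = subst (0ℚ ≤_) e (0≤∣p∣ p)

  p≤∣p∣ : ∀ p → p ≤ ∣ p ∣
  p≤∣p∣ p with ≤-total 0ℚ p
  ... | inj₁ h = ≤-reflexive (sym (0≤p⇒∣p∣≡p h))
  ... | inj₂ h = ≤-trans h (0≤∣p∣ p)

  -p≤∣p∣ : ∀ p → - p ≤ ∣ p ∣
  -p≤∣p∣ p = subst (- p ≤_) (∣-p∣≡∣p∣ p) (p≤∣p∣ (- p))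

  ∣∣≤ : ∀ {p b} → p ≤ b → - p ≤ b → ∣ p ∣ ≤ b
  ∣∣≤ {p} {b} h k with ∣p∣≡p∨∣p∣≡-p p
  ... | inj₁ e = subst (_≤ b) (sym e) h
  ... | inj₂ e = subst (_≤ b) (sym e) k

  ∣-∣-sym : ∀ p q → ∣ p - q ∣ ≡ ∣ q - p ∣
  ∣-∣-sym p q = trans (sym (∣-p∣≡∣p∣ (p - q))) (cong ∣_∣ (solve 2 (λ p q → :- (p :- q) := q :- p) refl p q))

  ∣-∣-tri : ∀ p q r → ∣ p - r ∣ ≤ ∣ p - q ∣ + ∣ q - r ∣
  ∣-∣-tri p q r = subst (λ z → ∣ z ∣ ≤ ∣ p - q ∣ + ∣ q - r ∣)
    (solve 3 (λ p q r → (p :- q) :+ (q :- r) := p :- r) refl p q r) (∣p+q∣≤∣p∣+∣q∣ (p - q) (q - r))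

  half+half : ∀ ε → ½ * ε + ½ * ε ≡ ε
  half+half ε = trans (sym (*-distribʳ-+ ε ½ ½)) (*-identityˡ ε)

  half>0 : ∀ {ε} → 0ℚ < ε → 0ℚ < ½ * ε
  half>0 h = 0<* (positive⁻¹ ½) h

  upper : ∀ p → ∃ λ c → p ≤ ι c
  upper p@(mkℚ (+ a) d _) = a , toℚᵘ-cancel-≤ (ℚᵘₚ.≤-respʳ-≃ (ℚᵘₚ.≃-sym (/≃ (+ a) 0))
    (ℚᵘ.*≤* (ℤₚ.*-monoˡ-≤-nonNeg (+ a) (ℤ.+≤+ (ℕ.s≤s ℕ.z≤n)))))
  upper p@(mkℚ (ℤ.-[1+ a ]) d _) = 0 , nonPositive⁻¹ p

  recip-le : ∀ {ε} → 0ℚ < ε → ∃ λ d → 1ℚ ≤ ι (suc d) * ε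
  recip-le {ε} h = let instance nz = pos⇒nonZero ε {{positive h}}
                       c , q = upper (1/ ε)
                   in c , ≤-trans (≤-reflexive (sym (*-inverseˡ ε)))
                            (*-monoʳ ε (<⇒≤ h) (≤-trans q (ι-mono-≤ (ℕₚ.n≤1+n c))))

  archimedean : ∀ C ε → 0ℚ < ε → ∃ λ N → ∀ n → N ℕ.≤ n → C * (+ 1 / suc n) < ε
  archimedean C ε h with upper C | recip-le h
  ... | c , C≤c | d , 1≤dε = c ℕ.* suc d , λ n le → go n le
    where
    open ≤-Reasoning
    go : ∀ n → c ℕ.* suc d ℕ.≤ n → C * (+ 1 / suc n) < ε
    go n le = *-cancelˡ-<-nonNeg (ι (suc n)) {{nonNegative (0≤ι (suc n))}} (begin-strict
      ι (suc n) * (C * (+ 1 / suc n)) ≡⟨ solve 3 (λ a b c → a :* (b :* c) := b :* (a :* c)) refl (ι (suc n)) C (+ 1 / suc n) ⟩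
      C * (ι (suc n) * (+ 1 / suc n)) ≡⟨ cong (C *_) (ι*recip n) ⟩
      C * 1ℚ       ≡⟨ *-identityʳ C ⟩
      C            ≤⟨ C≤c ⟩
      ι c          ≡⟨ sym (*-identityʳ (ι c)) ⟩
      ι c * 1ℚ     ≤⟨ *-monoˡ (ι c) (0≤ι c) 1≤dε ⟩
      ι c * (ι (suc d) * ε)  ≡⟨ sym (*-assoc (ι c) (ι (suc d)) ε) ⟩
      ι c * ι (suc d) * ε    ≡⟨ cong (_* ε) (sym (ι-* c (suc d))) ⟩
      ι (c ℕ.* suc d) * ε    ≤⟨ *-monoʳ ε (<⇒≤ h) (ι-mono-≤ le) ⟩
      ι n * ε      ≡⟨ sym (+-identityˡ _) ⟩
      0ℚ + ι n * ε <⟨ +-monoˡ-< (ι n * ε) h ⟩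
      ε + ι n * ε  ≡⟨ solve 2 (λ e a → e :+ a :* e := (con 1ℚ :+ a) :* e) refl ε (ι n) ⟩
      (1ℚ + ι n) * ε ≡⟨ cong (_* ε) (sym (ι-+ 1 n)) ⟩
      ι (suc n) * ε ∎)

-- ∑ n f = f 0 + … + f (n - 1)
∑ : ℕ → (ℕ → ℚ) → ℚ
∑ zero    f = 0ℚ
∑ (suc n) f = ∑ n f + f n

-- isqrt n = ⌊√n⌋; see isqrt-lower and isqrt-upper.
isqrt : ℕ → ℕ
isqrt zero = zero
isqrt (suc n) with isqrt n
... | r with suc r ℕ.* suc r ℕ.≤? suc n
...   | yes _ = suc r
...   | no  _ = r

IsCauchy : (ℕ → ℚ) → Set
IsCauchy s = ∀ ε → 0ℚ < ε → ∃ λ N → ∀ m n → N ℕ.≤ m → N ℕ.≤ n → ∣ s m - s n ∣ < ε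

-- suc (cell n m) = suc n ℕ.* suc m definitionally
cell : ℕ → ℕ → ℕ
cell n m = m ℕ.+ n ℕ.* suc m

opaque
  ∑-cong : ∀ n {f g : ℕ → ℚ} → (∀ i → i ℕ.< n → f i ≡ g i) → ∑ n f ≡ ∑ n g
  ∑-cong zero    h = refl
  ∑-cong (suc n) h = cong₂ _+_ (∑-cong n λ i l → h i (ℕₚ.m<n⇒m<1+n l)) (h n ℕₚ.≤-refl)

  ∑-diff : ∀ n {f g d : ℕ → ℚ} → (∀ i → i ℕ.< n → ∣ f i - g i ∣ ≤ d i) → ∣ ∑ n f - ∑ n g ∣ ≤ ∑ n d
  ∑-diff zero    h = ≤-refl
  ∑-diff (suc n) {f} {g} {d} h = subst (λ z → ∣ z ∣ ≤ ∑ n d + d n)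
    (solve 4 (λ a b c d → (a :- c) :+ (b :- d) := (a :+ b) :- (c :+ d)) refl (∑ n f) (f n) (∑ n g) (g n))
    (≤-trans (∣p+q∣≤∣p∣+∣q∣ (∑ n f - ∑ n g) (f n - g n))
      (+-mono-≤ (∑-diff n λ i l → h i (ℕₚ.m<n⇒m<1+n l)) (h n ℕₚ.≤-refl)))

  ∑-* : ∀ n (f : ℕ → ℚ) c → ∑ n (λ i → c * f i) ≡ c * ∑ n f
  ∑-* zero    f c = sym (*-zeroʳ c)
  ∑-* (suc n) f c = trans (cong (_+ c * f n) (∑-* n f c)) (sym (*-distribˡ-+ c (∑ n f) (f n)))

  ∑-const : ∀ n c → ∑ n (λ _ → c) ≡ ι n * c
  ∑-const zero    c = sym (*-zeroˡ c)
  ∑-const (suc n) c = trans (cong (_+ c) (∑-const n c))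
    (trans (solve 2 (λ a c → a :* c :+ c := (con 1ℚ :+ a) :* c) refl (ι n) c) (cong (_* c) (sym (ι-+ 1 n))))

  ∑-telescope : ∀ n (f : ℕ → ℚ) c → ∑ n (λ i → (f i - f (suc i)) + c) ≡ (f 0 - f n) + ι n * c
  ∑-telescope zero    f c = sym (trans (cong₂ _+_ (+-inverseʳ (f 0)) (*-zeroˡ c)) refl)
  ∑-telescope (suc n) f c = trans (cong (_+ ((f n - f (suc n)) + c)) (∑-telescope n f c))
    (trans (solve 5 (λ a b d i c → ((a :- b) :+ i :* c) :+ ((b :- d) :+ c) := (a :- d) :+ (con 1ℚ :+ i) :* c)
              refl (f 0) (f n) (f (suc n)) (ι n) c)
       (cong (λ z → (f 0 - f (suc n)) + z * c) (sym (ι-+ 1 n))))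

  ∑-add : ∀ k m (g : ℕ → ℚ) → ∑ (k ℕ.+ m) g ≡ ∑ k g + ∑ m (λ j → g (k ℕ.+ j))
  ∑-add k zero    g = trans (cong (λ z → ∑ z g) (ℕₚ.+-identityʳ k)) (sym (+-identityʳ (∑ k g)))
  ∑-add k (suc m) g = trans (cong (λ z → ∑ z g) (ℕₚ.+-suc k m))
    (trans (cong (_+ g (k ℕ.+ m)) (∑-add k m g)) (+-assoc (∑ k g) (∑ m (λ j → g (k ℕ.+ j))) (g (k ℕ.+ m))))

  ∑-block : ∀ n m (g : ℕ → ℚ) → ∑ (n ℕ.* m) g ≡ ∑ n (λ i → ∑ m (λ j → g (i ℕ.* m ℕ.+ j)))
  ∑-block zero    m g = refl
  ∑-block (suc n) m g = trans (cong (λ z → ∑ z g) (ℕₚ.+-comm m (n ℕ.* m)))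
    (trans (∑-add (n ℕ.* m) m g) (cong (_+ ∑ m (λ j → g (n ℕ.* m ℕ.+ j))) (∑-block n m g)))

  block-diff : ∀ n m {t s e : ℕ → ℚ} →
    (∀ i j → i ℕ.< n → j ℕ.< m → ∣ t (i ℕ.* m ℕ.+ j) - s i ∣ ≤ e i) →
    ∣ ∑ (n ℕ.* m) t - ∑ n (λ i → ι m * s i) ∣ ≤ ∑ n (λ i → ι m * e i)
  block-diff n m {t} {s} {e} h = subst (λ z → ∣ z - ∑ n (λ i → ι m * s i) ∣ ≤ ∑ n (λ i → ι m * e i))
    (sym (∑-block n m t))
    (∑-diff n λ i l → subst₂ (λ y z → ∣ ∑ m (λ j → t (i ℕ.* m ℕ.+ j)) - y ∣ ≤ z) (∑-const m (s i)) (∑-const m (e i))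
       (∑-diff m λ j l′ → h i j l l′))

  cell-comm : ∀ n m → cell n m ≡ cell m n
  cell-comm n m = ℕₚ.suc-injective (ℕₚ.*-comm (suc n) (suc m))

  recip-cell : ∀ n m → ι (suc m) * (+ 1 / suc (cell n m)) ≡ + 1 / suc n
  recip-cell n m = begin
    M * K                ≡⟨ sym (*-identityˡ (M * K)) ⟩
    1ℚ * (M * K)         ≡⟨ cong (_* (M * K)) (sym (ι*recip n)) ⟩
    (ι (suc n) * R) * (M * K) ≡⟨ solve 4 (λ a r m k → (a :* r) :* (m :* k) := r :* ((a :* m) :* k)) refl (ι (suc n)) R M K ⟩
    R * (ι (suc n) * M * K)   ≡⟨ cong (λ z → R * (z * K)) (sym (ι-* (suc n) (suc m))) ⟩
    R * (ι (suc n ℕ.* suc m) * K) ≡⟨ cong (R *_) (ι*recip (cell n m)) ⟩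
    R * 1ℚ               ≡⟨ *-identityʳ R ⟩
    R ∎
    where
    open ≡-Reasoning
    M K R : ℚ
    M = ι (suc m)
    K = + 1 / suc (cell n m)
    R = + 1 / suc n

  refine⇒close : ∀ (s : ℕ → ℚ) C → (∀ n m → ∣ s (cell n m) - s n ∣ ≤ C * (+ 1 / suc n)) →
    ∀ n m → ∣ s n - s m ∣ ≤ C * (+ 1 / suc n) + C * (+ 1 / suc m)
  refine⇒close s C h n m = ≤-trans (∣-∣-tri (s n) (s (cell n m)) (s m))
    (+-mono-≤ (subst (_≤ C * (+ 1 / suc n)) (∣-∣-sym (s (cell n m)) (s n)) (h n m))
              (subst (λ z → ∣ s z - s m ∣ ≤ C * (+ 1 / suc m)) (cell-comm m n) (h m n)))

  refine⇒cauchy : ∀ (s : ℕ → ℚ) C → (∀ n m → ∣ s (cell n m) - s n ∣ ≤ C * (+ 1 / suc n)) → IsCauchy s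
  refine⇒cauchy s C h ε ε>0 with archimedean C (½ * ε) (half>0 ε>0)
  ... | N , small = N , λ m n N≤m N≤n → ≤-<-trans (refine⇒close s C h m n)
          (subst (C * (+ 1 / suc m) + C * (+ 1 / suc n) <_) (half+half ε) (+-mono-< (small m N≤m) (small n N≤n)))

  isqrt-lower : ∀ n → isqrt n ℕ.* isqrt n ℕ.≤ n
  isqrt-lower zero = ℕ.z≤n
  isqrt-lower (suc n) with isqrt n | isqrt-lower n
  ... | r | ih with suc r ℕ.* suc r ℕ.≤? suc n
  ...   | yes p = p
  ...   | no  _ = ℕₚ.m≤n⇒m≤1+n ih

  isqrt-upper : ∀ n → n ℕ.< suc (isqrt n) ℕ.* suc (isqrt n)
  isqrt-upper zero = ℕ.s≤s ℕ.z≤n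
  isqrt-upper (suc n) with isqrt n | isqrt-upper n
  ... | r | ih with suc r ℕ.* suc r ℕ.≤? suc n
  ...   | yes p = ℕₚ.≤-<-trans ih (ℕₚ.*-mono-< (ℕₚ.n<1+n (suc r)) (ℕₚ.n<1+n (suc r)))
  ...   | no ¬p = ℕₚ.≰⇒> ¬p

  sq-cancel-< : ∀ {a b} → a ℕ.* a ℕ.< b ℕ.* b → a ℕ.< b
  sq-cancel-< {a} {b} h = ℕₚ.≰⇒> λ b≤a → ℕₚ.<⇒≱ h (ℕₚ.*-mono-≤ b≤a b≤a)

  isqrt-greatest : ∀ {x n} → x ℕ.* x ℕ.≤ n → x ℕ.≤ isqrt n
  isqrt-greatest {x} {n} h = ℕₚ.≤-pred (sq-cancel-< (ℕₚ.≤-<-trans h (isqrt-upper n)))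

  isqrt-mono : ∀ {a b} → a ℕ.≤ b → isqrt a ℕ.≤ isqrt b
  isqrt-mono {a} h = isqrt-greatest (ℕₚ.≤-trans (isqrt-lower a) h)

  sq-* : ∀ a b → (a ℕ.* b) ℕ.* (a ℕ.* b) ≡ (a ℕ.* a) ℕ.* (b ℕ.* b)
  sq-* a b = S.solve 2 (λ a b → (a S.:* b) S.:* (a S.:* b) S.:= (a S.:* a) S.:* (b S.:* b)) refl a b
    where module S = ℕ-Solver.+-*-Solver

  isqrt-scale-≥ : ∀ M a → M ℕ.* isqrt a ℕ.≤ isqrt ((M ℕ.* M) ℕ.* a)
  isqrt-scale-≥ M a = isqrt-greatest (subst (ℕ._≤ (M ℕ.* M) ℕ.* a) (sym (sq-* M (isqrt a)))
    (ℕₚ.*-monoʳ-≤ (M ℕ.* M) (isqrt-lower a)))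

  isqrt-scale-≤ : ∀ m a → isqrt ((suc m ℕ.* suc m) ℕ.* a) ℕ.≤ suc m ℕ.* suc (isqrt a)
  isqrt-scale-≤ m a = ℕₚ.<⇒≤ (sq-cancel-< (ℕₚ.≤-<-trans (isqrt-lower ((suc m ℕ.* suc m) ℕ.* a))
    (subst ((suc m ℕ.* suc m) ℕ.* a ℕ.<_) (sym (sq-* (suc m) (suc (isqrt a))))
      (ℕₚ.*-monoʳ-< (suc m ℕ.* suc m) (isqrt-upper a)))))

  isqrt-sq : ∀ n → isqrt (n ℕ.* n) ≡ n
  isqrt-sq n = ℕₚ.≤-antisym (ℕₚ.≤-pred (sq-cancel-< (ℕₚ.≤-<-trans (isqrt-lower (n ℕ.* n)) (ℕₚ.*-mono-< (ℕₚ.n<1+n n) (ℕₚ.n<1+n n))))) (isqrt-greatest ℕₚ.≤-refl)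

  -- x/N with N = suc n, compared on the grid refined by M = suc m
  frac-≤ : ∀ n m {x y} → x ℕ.≤ suc m ℕ.* y → + x / suc (cell n m) ≤ + y / suc n
  frac-≤ n m {x} {y} h = begin
    + x / suc (cell n m)                      ≡⟨ frac x (cell n m) ⟩
    ι x * (+ 1 / suc (cell n m))              ≤⟨ *-monoʳ (+ 1 / suc (cell n m)) (recip≥0 (cell n m)) (ι-mono-≤ h) ⟩
    ι (suc m ℕ.* y) * (+ 1 / suc (cell n m))  ≡⟨ cong (_* (+ 1 / suc (cell n m))) (ι-* (suc m) y) ⟩
    ι (suc m) * ι y * (+ 1 / suc (cell n m))  ≡⟨ solve 3 (λ a b c → a :* b :* c := b :* (a :* c)) refl (ι (suc m)) (ι y) (+ 1 / suc (cell n m)) ⟩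
    ι y * (ι (suc m) * (+ 1 / suc (cell n m))) ≡⟨ cong (ι y *_) (recip-cell n m) ⟩
    ι y * (+ 1 / suc n)                       ≡⟨ sym (frac y n) ⟩
    + y / suc n ∎
    where open ≤-Reasoning

  frac-≥ : ∀ n m {x y} → suc m ℕ.* y ℕ.≤ x → + y / suc n ≤ + x / suc (cell n m)
  frac-≥ n m {x} {y} h = begin
    + y / suc n                       ≡⟨ frac y n ⟩
    ι y * (+ 1 / suc n)               ≡⟨ cong (ι y *_) (sym (recip-cell n m)) ⟩
    ι y * (ι (suc m) * (+ 1 / suc (cell n m))) ≡⟨ solve 3 (λ a b c → b :* (a :* c) := a :* b :* c) refl (ι (suc m)) (ι y) (+ 1 / suc (cell n m)) ⟩
    ι (suc m) * ι y * (+ 1 / suc (cell n m))  ≡⟨ cong (_* (+ 1 / suc (cell n m))) (sym (ι-* (suc m) y)) ⟩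
    ι (suc m ℕ.* y) * (+ 1 / suc (cell n m))  ≤⟨ *-monoʳ (+ 1 / suc (cell n m)) (recip≥0 (cell n m)) (ι-mono-≤ h) ⟩
    ι x * (+ 1 / suc (cell n m))              ≡⟨ sym (frac x (cell n m)) ⟩
    + x / suc (cell n m)                      ∎
    where open ≤-Reasoning

  frac-suc : ∀ y n → + suc y / suc n ≡ + y / suc n + (+ 1 / suc n)
  frac-suc y n = trans (frac (suc y) n) (trans (cong (_* (+ 1 / suc n)) (ι-+ 1 y))
    (trans (solve 2 (λ a r → (con 1ℚ :+ a) :* r := a :* r :+ r) refl (ι y) (+ 1 / suc n))
      (cong (_+ (+ 1 / suc n)) (sym (frac y n)))))

  frac-0 : ∀ n → + 0 / suc n ≡ 0ℚ
  frac-0 n = trans (frac 0 n) (*-zeroˡ (+ 1 / suc n))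

  frac-1 : ∀ n → + suc n / suc n ≡ 1ℚ
  frac-1 n = trans (frac (suc n) n) (ι*recip n)

-- ⌊N √a⌋ / N for N = suc n
√seq : ℕ → ℕ → ℚ
√seq a n = + isqrt (a ℕ.* (suc n ℕ.* suc n)) / suc n

-- With N = suc n, quarterDisc n is the left Riemann sum with mesh 1/N of
-- ∫₀¹ √(1 - x²) dx, the value √(1 - (i/N)²) being rounded down to a multiple
-- of 1/N.  Equivalently it is 1/N² times the number of lattice points (i , j)
-- with 0 ≤ i < N, 0 < j and i² + j² ≤ N².
height : ℕ → ℕ → ℚ
height n i = + isqrt (suc n ℕ.* suc n ℕ.∸ i ℕ.* i) / suc n

quarterDisc : ℕ → ℚ
quarterDisc n = ∑ (suc n) λ i → height n i * (+ 1 / suc n)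

opaque
  √seq-refine : ∀ a n m → ∣ √seq a (cell n m) - √seq a n ∣ ≤ 1ℚ * (+ 1 / suc n)
  √seq-refine a n m = ∣∣≤
      (0≤⇒≤ (subst (0ℚ ≤_) (solve 3 (λ p q r → (q :+ r) :- p := con 1ℚ :* r :- (p :- q)) refl S′ S R) (≤⇒0≤ up)))
      (0≤⇒≤ (subst (0ℚ ≤_) (solve 3 (λ p q r → r :+ (p :- q) := con 1ℚ :* r :- (:- (p :- q))) refl S′ S R)
        (0≤+ (recip≥0 n) (≤⇒0≤ lo))))
    where
    N M : ℕ
    N = suc n
    M = suc m
    S′ S R : ℚ
    S′ = √seq a (cell n m)
    S = √seq a n
    R = + 1 / suc n
    eq : a ℕ.* ((N ℕ.* M) ℕ.* (N ℕ.* M)) ≡ (M ℕ.* M) ℕ.* (a ℕ.* (N ℕ.* N))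
    eq = Z.solve 3 (λ a n m → a Z.:* ((n Z.:* m) Z.:* (n Z.:* m)) Z.:= (m Z.:* m) Z.:* (a Z.:* (n Z.:* n))) refl a N M
      where module Z = ℕ-Solver.+-*-Solver
    up : S′ ≤ S + R
    up = subst (S′ ≤_) (frac-suc (isqrt (a ℕ.* (N ℕ.* N))) n)
      (frac-≤ n m (subst (λ z → isqrt z ℕ.≤ M ℕ.* suc (isqrt (a ℕ.* (N ℕ.* N)))) (sym eq) (isqrt-scale-≤ m (a ℕ.* (N ℕ.* N)))))
    lo : S ≤ S′
    lo = frac-≥ n m (subst (λ z → M ℕ.* isqrt (a ℕ.* (N ℕ.* N)) ℕ.≤ isqrt z) (sym eq) (isqrt-scale-≥ M (a ℕ.* (N ℕ.* N))))

  height-diff : ∀ n m i j → j ℕ.< suc m →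
    ∣ height (cell n m) (i ℕ.* suc m ℕ.+ j) - height n i ∣ ≤ (height n i - height n (suc i)) + (+ 1 / suc n)
  height-diff n m i j j<M = ∣∣≤
      (0≤⇒≤ (subst (0ℚ ≤_) (solve 4 (λ p q q′ r → ((q :+ r) :- p) :+ (q :- q′) := ((q :- q′) :+ r) :- (p :- q)) refl H H₀ H₁ R)
         (0≤+ (≤⇒0≤ up) (≤⇒0≤ anti))))
      (0≤⇒≤ (subst (0ℚ ≤_) (solve 4 (λ p q q′ r → r :+ (p :- q′) := ((q :- q′) :+ r) :- (:- (p :- q))) refl H H₀ H₁ R)
        (0≤+ (recip≥0 n) (≤⇒0≤ lo))))
    where
    N M k : ℕ
    N = suc n
    M = suc m
    k = i ℕ.* M ℕ.+ j
    H H₀ H₁ R : ℚ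
    H = height (cell n m) k
    H₀ = height n i
    H₁ = height n (suc i)
    R = + 1 / suc n
    scale : ∀ x → (N ℕ.* M) ℕ.* (N ℕ.* M) ℕ.∸ (x ℕ.* M) ℕ.* (x ℕ.* M) ≡ (M ℕ.* M) ℕ.* (N ℕ.* N ℕ.∸ x ℕ.* x)
    scale x = trans (cong₂ ℕ._∸_ (trans (sq-* N M) (ℕₚ.*-comm (N ℕ.* N) (M ℕ.* M))) (trans (sq-* x M) (ℕₚ.*-comm (x ℕ.* x) (M ℕ.* M))))
      (sym (ℕₚ.*-distribˡ-∸ (M ℕ.* M) (N ℕ.* N) (x ℕ.* x)))
    lower≤ : i ℕ.* M ℕ.≤ k
    lower≤ = ℕₚ.m≤m+n (i ℕ.* M) j
    ≤upper : k ℕ.≤ suc i ℕ.* M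
    ≤upper = subst (k ℕ.≤_) (ℕₚ.+-comm (i ℕ.* M) M) (ℕₚ.+-monoʳ-≤ (i ℕ.* M) (ℕₚ.<⇒≤ j<M))
    up : H ≤ H₀ + R
    up = subst (H ≤_) (frac-suc (isqrt (N ℕ.* N ℕ.∸ i ℕ.* i)) n)
      (frac-≤ n m (ℕₚ.≤-trans
        (isqrt-mono (ℕₚ.∸-monoʳ-≤ ((N ℕ.* M) ℕ.* (N ℕ.* M)) (ℕₚ.*-mono-≤ lower≤ lower≤)))
        (subst (λ z → isqrt z ℕ.≤ M ℕ.* suc (isqrt (N ℕ.* N ℕ.∸ i ℕ.* i))) (sym (scale i)) (isqrt-scale-≤ m (N ℕ.* N ℕ.∸ i ℕ.* i)))))
    lo : H₁ ≤ H
    lo = frac-≥ n m (ℕₚ.≤-trans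
        (subst (λ z → M ℕ.* isqrt (N ℕ.* N ℕ.∸ suc i ℕ.* suc i) ℕ.≤ isqrt z) (sym (scale (suc i))) (isqrt-scale-≥ M (N ℕ.* N ℕ.∸ suc i ℕ.* suc i)))
        (isqrt-mono (ℕₚ.∸-monoʳ-≤ ((N ℕ.* M) ℕ.* (N ℕ.* M)) (ℕₚ.*-mono-≤ ≤upper ≤upper))))
    anti : H₁ ≤ H₀
    anti = subst₂ _≤_ (sym (frac (isqrt (N ℕ.* N ℕ.∸ suc i ℕ.* suc i)) n)) (sym (frac (isqrt (N ℕ.* N ℕ.∸ i ℕ.* i)) n))
      (*-monoʳ R (recip≥0 n) (ι-mono-≤ (isqrt-mono (ℕₚ.∸-monoʳ-≤ (N ℕ.* N) (ℕₚ.*-mono-≤ (ℕₚ.n≤1+n i) (ℕₚ.n≤1+n i))))))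

  quarterDisc-refine : ∀ n m → ∣ quarterDisc (cell n m) - quarterDisc n ∣ ≤ (1ℚ + 1ℚ) * (+ 1 / suc n)
  quarterDisc-refine n m = subst₂ (λ y z → ∣ quarterDisc (cell n m) - y ∣ ≤ z) eqs eqe
      (block-diff (suc n) (suc m) {t = λ k → height (cell n m) k * K} {s = λ i → height n i * K} {e = e} bound)
    where
    K R : ℚ
    K = + 1 / suc (cell n m)
    R = + 1 / suc n
    d e : ℕ → ℚ
    d i = (height n i - height n (suc i)) + R
    e i = d i * K
    bound : ∀ i j → i ℕ.< suc n → j ℕ.< suc m → ∣ height (cell n m) (i ℕ.* suc m ℕ.+ j) * K - height n i * K ∣ ≤ e i
    bound i j _ l = subst (_≤ e i) eq (*-monoʳ K (recip≥0 (cell n m)) (height-diff n m i j l))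
      where
      x y : ℚ
      x = height (cell n m) (i ℕ.* suc m ℕ.+ j)
      y = height n i
      eq : ∣ x - y ∣ * K ≡ ∣ x * K - y * K ∣
      eq = trans (cong (∣ x - y ∣ *_) (sym (0≤p⇒∣p∣≡p (recip≥0 (cell n m)))))
        (trans (sym (∣p*q∣≡∣p∣*∣q∣ (x - y) K)) (cong ∣_∣ (solve 3 (λ x y k → (x :- y) :* k := x :* k :- y :* k) refl x y K)))
    scale : ∀ p → ι (suc m) * (p * K) ≡ p * R
    scale p = trans (solve 3 (λ a p k → a :* (p :* k) := p :* (a :* k)) refl (ι (suc m)) p K) (cong (p *_) (recip-cell n m))
    eqs : ∑ (suc n) (λ i → ι (suc m) * (height n i * K)) ≡ quarterDisc n
    eqs = ∑-cong (suc n) λ i _ → scale (height n i)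
    h0 : height n 0 ≡ 1ℚ
    h0 = trans (cong (λ z → + z / suc n) (isqrt-sq (suc n))) (frac-1 n)
    hN : height n (suc n) ≡ 0ℚ
    hN = trans (cong (λ z → + isqrt z / suc n) (ℕₚ.n∸n≡0 (suc n ℕ.* suc n))) (frac-0 n)
    eqe : ∑ (suc n) (λ i → ι (suc m) * e i) ≡ (1ℚ + 1ℚ) * R
    eqe = trans (∑-cong (suc n) λ i _ → trans (scale (d i)) (*-comm (d i) R))
      (trans (∑-* (suc n) d R) (trans (*-comm R (∑ (suc n) d)) (cong (_* R)
        (trans (∑-telescope (suc n) (height n) R)
          (cong₂ _+_ (cong₂ _-_ h0 hN) (ι*recip n))))))

1+sq-positive : ∀ t → Positive (1ℚ + t * t)
1+sq-positive t = pos+nonNeg⇒pos 1ℚ (t * t) {{nonNegative (0≤sq t)}}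

1/1+sq : ℚ → ℚ
1/1+sq t = (1/ (1ℚ + t * t)) {{pos⇒nonZero (1ℚ + t * t) {{1+sq-positive t}}}}

-- Left Riemann sum of ∫₀ᵇ f(t) dt on suc n equal subintervals; for b < 0 the
-- integral is oriented.
riemann : (ℚ → ℚ) → ℚ → ℕ → ℚ
riemann f b n = ∑ (suc n) λ i → f ((+ i / suc n) * b) * (b * (+ 1 / suc n))

opaque
  1/1+sq-inverse : ∀ t → 1/1+sq t * (1ℚ + t * t) ≡ 1ℚ
  1/1+sq-inverse t = *-inverseˡ (1ℚ + t * t) {{pos⇒nonZero (1ℚ + t * t) {{1+sq-positive t}}}}

  1/1+sq≥0 : ∀ t → 0ℚ ≤ 1/1+sq t
  1/1+sq≥0 t = <⇒≤ (positive⁻¹ (1/1+sq t) {{1/pos⇒pos (1ℚ + t * t) {{1+sq-positive t}}}})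

  scaled-le-1 : ∀ a b w → 0ℚ ≤ (1ℚ + a * a) * (1ℚ + b * b) - w → 0ℚ ≤ (1ℚ + a * a) * (1ℚ + b * b) + w →
    ∣ w * (1/1+sq a * 1/1+sq b) ∣ ≤ 1ℚ
  scaled-le-1 a b w h k = ∣∣≤
      (0≤⇒≤ (subst (0ℚ ≤_) (trans (solve 5 (λ p q x y w → (x :* y) :* (p :* q :- w) := (x :* p) :* (y :* q) :- w :* (x :* y)) refl P Q X Y w)
                 (cong (_- w * (X * Y)) XPYQ)) (0≤* XY h)))
      (0≤⇒≤ (subst (0ℚ ≤_) (trans (solve 5 (λ p q x y w → (x :* y) :* (p :* q :+ w) := (x :* p) :* (y :* q) :- :- (w :* (x :* y))) refl P Q X Y w)
                 (cong (_- (- (w * (X * Y)))) XPYQ)) (0≤* XY k)))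
    where
    P Q X Y : ℚ
    P = 1ℚ + a * a
    Q = 1ℚ + b * b
    X = 1/1+sq a
    Y = 1/1+sq b
    XY : 0ℚ ≤ X * Y
    XY = 0≤* (1/1+sq≥0 a) (1/1+sq≥0 b)
    XPYQ : (X * P) * (Y * Q) ≡ 1ℚ
    XPYQ = cong₂ _*_ (1/1+sq-inverse a) (1/1+sq-inverse b)

  ∣*∣≤ : ∀ u v → ∣ v ∣ ≤ 1ℚ → ∣ u * v ∣ ≤ ∣ u ∣
  ∣*∣≤ u v h = subst₂ _≤_ (sym (∣p*q∣≡∣p∣*∣q∣ u v)) (*-identityʳ ∣ u ∣) (*-monoˡ ∣ u ∣ (0≤∣p∣ u) h)

  0≤ab² : ∀ a b → 0ℚ ≤ a * a * (b * b)
  0≤ab² a b = 0≤* (0≤sq a) (0≤sq b)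

  1/1+sq-lipschitz : ∀ a b → ∣ 1/1+sq a - 1/1+sq b ∣ ≤ ∣ a - b ∣
  1/1+sq-lipschitz a b = subst (_≤ ∣ a - b ∣) (cong ∣_∣ eq) (∣*∣≤ (a - b) (- (a + b) * (X * Y))
      (scaled-le-1 a b (- (a + b))
        (subst (0ℚ ≤_) (solve 2 (λ a b → ((con ½ :+ a) :* (con ½ :+ a) :+ (con ½ :+ b) :* (con ½ :+ b)) :+ (con ½ :+ a :* a :* (b :* b))
             := (con 1ℚ :+ a :* a) :* (con 1ℚ :+ b :* b) :- (:- (a :+ b))) refl a b)
           (0≤+ (0≤+ (0≤sq (½ + a)) (0≤sq (½ + b))) (0≤+ (nonNegative⁻¹ ½) (0≤ab² a b))))
        (subst (0ℚ ≤_) (solve 2 (λ a b → ((con ½ :- a) :* (con ½ :- a) :+ (con ½ :- b) :* (con ½ :- b)) :+ (con ½ :+ a :* a :* (b :* b))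
             := (con 1ℚ :+ a :* a) :* (con 1ℚ :+ b :* b) :+ (:- (a :+ b))) refl a b)
           (0≤+ (0≤+ (0≤sq (½ - a)) (0≤sq (½ - b))) (0≤+ (nonNegative⁻¹ ½) (0≤ab² a b))))))
    where
    X Y : ℚ
    X = 1/1+sq a
    Y = 1/1+sq b
    eq : (a - b) * (- (a + b) * (X * Y)) ≡ X - Y
    eq = trans (solve 4 (λ a b x y → (a :- b) :* (:- (a :+ b) :* (x :* y))
                 := x :* (y :* (con 1ℚ :+ b :* b)) :- y :* (x :* (con 1ℚ :+ a :* a))) refl a b X Y)
          (trans (cong₂ (λ u v → X * u - Y * v) (1/1+sq-inverse b) (1/1+sq-inverse a))
            (cong₂ _-_ (*-identityʳ X) (*-identityʳ Y)))

  term-lipschitz : ∀ c p q → ∣ p * 1/1+sq (c * p) - q * 1/1+sq (c * q) ∣ ≤ ∣ p - q ∣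
  term-lipschitz c p q = subst (_≤ ∣ p - q ∣) (cong ∣_∣ eq) (∣*∣≤ (p - q) ((1ℚ - a * b) * (X * Y))
      (scaled-le-1 a b (1ℚ - a * b)
        (subst (0ℚ ≤_) (solve 2 (λ a b → (con ½ :* ((a :+ b) :* (a :+ b)) :+ (con ½ :* (a :* a) :+ con ½ :* (b :* b))) :+ a :* a :* (b :* b)
             := (con 1ℚ :+ a :* a) :* (con 1ℚ :+ b :* b) :- (con 1ℚ :- a :* b)) refl a b)
           (0≤+ (0≤+ (½* (0≤sq (a + b))) (0≤+ (½* (0≤sq a)) (½* (0≤sq b)))) (0≤ab² a b)))
        (subst (0ℚ ≤_) (solve 2 (λ a b → (con ½ :* ((a :- b) :* (a :- b)) :+ (con ½ :* (a :* a) :+ con ½ :* (b :* b))) :+ (con (1ℚ + 1ℚ) :+ a :* a :* (b :* b))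
             := (con 1ℚ :+ a :* a) :* (con 1ℚ :+ b :* b) :+ (con 1ℚ :- a :* b)) refl a b)
           (0≤+ (0≤+ (½* (0≤sq (a - b))) (0≤+ (½* (0≤sq a)) (½* (0≤sq b)))) (0≤+ (nonNegative⁻¹ (1ℚ + 1ℚ)) (0≤ab² a b))))))
    where
    a b X Y : ℚ
    a = c * p
    b = c * q
    X = 1/1+sq a
    Y = 1/1+sq b
    ½* : ∀ {u} → 0ℚ ≤ u → 0ℚ ≤ ½ * u
    ½* = 0≤* (nonNegative⁻¹ ½)
    eq : (p - q) * ((1ℚ - a * b) * (X * Y)) ≡ p * X - q * Y
    eq = trans (solve 5 (λ c p q x y → (p :- q) :* ((con 1ℚ :- (c :* p) :* (c :* q)) :* (x :* y))
                 := p :* (x :* (y :* (con 1ℚ :+ (c :* q) :* (c :* q)))) :- q :* (y :* (x :* (con 1ℚ :+ (c :* p) :* (c :* p))))) refl c p q X Y)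
          (trans (cong₂ (λ u v → p * (X * u) - q * (Y * v)) (1/1+sq-inverse b) (1/1+sq-inverse a))
            (cong₂ (λ u v → p * u - q * v) (*-identityʳ X) (*-identityʳ Y)))

  riemann-lipschitz : ∀ p q n → ∣ riemann 1/1+sq p n - riemann 1/1+sq q n ∣ ≤ ∣ p - q ∣
  riemann-lipschitz p q n = ≤-trans (∑-diff (suc n) {f = λ i → 1/1+sq ((+ i / suc n) * p) * (p * R)}
        {g = λ i → 1/1+sq ((+ i / suc n) * q) * (q * R)} {d = λ _ → ∣ p - q ∣ * R} bound)
      (≤-reflexive (trans (∑-const (suc n) (∣ p - q ∣ * R))
        (trans (solve 3 (λ a d r → a :* (d :* r) := d :* (a :* r)) refl (ι (suc n)) ∣ p - q ∣ R)
          (trans (cong (∣ p - q ∣ *_) (ι*recip n)) (*-identityʳ ∣ p - q ∣)))))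
    where
    R : ℚ
    R = + 1 / suc n
    bound : ∀ i → i ℕ.< suc n → ∣ 1/1+sq ((+ i / suc n) * p) * (p * R) - 1/1+sq ((+ i / suc n) * q) * (q * R) ∣ ≤ ∣ p - q ∣ * R
    bound i _ = subst (_≤ ∣ p - q ∣ * R) eq (*-monoʳ R (recip≥0 n) (term-lipschitz c p q))
      where
      c X Y : ℚ
      c = + i / suc n
      X = 1/1+sq (c * p)
      Y = 1/1+sq (c * q)
      eq : ∣ p * X - q * Y ∣ * R ≡ ∣ X * (p * R) - Y * (q * R) ∣
      eq = trans (cong (∣ p * X - q * Y ∣ *_) (sym (0≤p⇒∣p∣≡p (recip≥0 n))))
        (trans (sym (∣p*q∣≡∣p∣*∣q∣ (p * X - q * Y) R))
          (cong ∣_∣ (solve 5 (λ p q x y r → (p :* x :- q :* y) :* r := x :* (p :* r) :- y :* (q :* r)) refl p q X Y R)))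

  node-diff : ∀ n m i j → j ℕ.< suc m →
    ∣ (+ (i ℕ.* suc m ℕ.+ j) / suc (cell n m)) - (+ i / suc n) ∣ ≤ + 1 / suc n
  node-diff n m i j l = ∣∣≤
     (0≤⇒≤ (subst (0ℚ ≤_) (trans (cong (_- x) (frac-suc i n)) (solve 3 (λ y r x → (y :+ r) :- x := r :- (x :- y)) refl y R x)) (≤⇒0≤ up)))
     (0≤⇒≤ (subst (0ℚ ≤_) (solve 3 (λ y r x → r :+ (x :- y) := r :- (:- (x :- y))) refl y R x) (0≤+ (recip≥0 n) (≤⇒0≤ lo))))
    where
    x y R : ℚ
    x = + (i ℕ.* suc m ℕ.+ j) / suc (cell n m)
    y = + i / suc n
    R = + 1 / suc n
    up : x ≤ + suc i / suc n
    up = frac-≤ n m (subst (i ℕ.* suc m ℕ.+ j ℕ.≤_) (trans (ℕₚ.+-comm (i ℕ.* suc m) (suc m)) (ℕₚ.*-comm (suc i) (suc m))) (ℕₚ.+-monoʳ-≤ (i ℕ.* suc m) (ℕₚ.<⇒≤ l)))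
    lo : y ≤ x
    lo = frac-≥ n m (subst (ℕ._≤ i ℕ.* suc m ℕ.+ j) (ℕₚ.*-comm i (suc m)) (ℕₚ.m≤m+n (i ℕ.* suc m) j))

  riemann-refine : ∀ b n m → ∣ riemann 1/1+sq b (cell n m) - riemann 1/1+sq b n ∣ ≤ (∣ b ∣ * ∣ b ∣) * (+ 1 / suc n)
  riemann-refine b n m = subst₂ (λ y z → ∣ riemann 1/1+sq b (cell n m) - y ∣ ≤ z) eqs eqe
      (block-diff (suc n) (suc m) {t = λ k → 1/1+sq ((+ k / suc (cell n m)) * b) * (b * K)}
         {s = λ i → 1/1+sq ((+ i / suc n) * b) * (b * K)} {e = λ _ → (B * R) * (B * K)} bound)
    where
    K R B : ℚ
    K = + 1 / suc (cell n m)
    R = + 1 / suc n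
    B = ∣ b ∣
    bound : ∀ i j → i ℕ.< suc n → j ℕ.< suc m →
      ∣ 1/1+sq ((+ (i ℕ.* suc m ℕ.+ j) / suc (cell n m)) * b) * (b * K) - 1/1+sq ((+ i / suc n) * b) * (b * K) ∣ ≤ (B * R) * (B * K)
    bound i j _ l = subst (_≤ (B * R) * (B * K)) eq
        (*-monoʳ (B * K) (0≤* (0≤∣p∣ b) (recip≥0 (cell n m)))
          (≤-trans (1/1+sq-lipschitz (x * b) (y * b))
            (subst₂ _≤_ (trans (sym (∣p*q∣≡∣p∣*∣q∣ b (x - y))) (cong ∣_∣ (solve 3 (λ b x y → b :* (x :- y) := x :* b :- y :* b) refl b x y))) refl
              (*-monoˡ B (0≤∣p∣ b) (node-diff n m i j l)))))
      where
      x y X Y : ℚ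
      x = + (i ℕ.* suc m ℕ.+ j) / suc (cell n m)
      y = + i / suc n
      X = 1/1+sq (x * b)
      Y = 1/1+sq (y * b)
      eq : ∣ X - Y ∣ * (B * K) ≡ ∣ X * (b * K) - Y * (b * K) ∣
      eq = trans (cong (λ z → ∣ X - Y ∣ * (B * z)) (sym (0≤p⇒∣p∣≡p (recip≥0 (cell n m)))))
        (trans (cong (∣ X - Y ∣ *_) (sym (∣p*q∣≡∣p∣*∣q∣ b K)))
        (trans (sym (∣p*q∣≡∣p∣*∣q∣ (X - Y) (b * K)))
          (cong ∣_∣ (solve 3 (λ x y k → (x :- y) :* k := x :* k :- y :* k) refl X Y (b * K)))))
    eqs : ∑ (suc n) (λ i → ι (suc m) * (1/1+sq ((+ i / suc n) * b) * (b * K))) ≡ riemann 1/1+sq b n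
    eqs = ∑-cong (suc n) λ i _ → trans
      (solve 4 (λ M x b k → M :* (x :* (b :* k)) := x :* (b :* (M :* k))) refl (ι (suc m)) (1/1+sq ((+ i / suc n) * b)) b K)
      (cong (λ z → 1/1+sq ((+ i / suc n) * b) * (b * z)) (recip-cell n m))
    eqe : ∑ (suc n) (λ _ → ι (suc m) * ((B * R) * (B * K))) ≡ (B * B) * R
    eqe = trans (∑-const (suc n) (ι (suc m) * ((B * R) * (B * K))))
      (trans (solve 5 (λ N M b r k → N :* (M :* ((b :* r) :* (b :* k))) := (b :* b) :* ((M :* k) :* (N :* r))) refl (ι (suc n)) (ι (suc m)) B R K)
        (cong ((B * B) *_) (trans (cong₂ _*_ (recip-cell n m) (ι*recip n)) (*-identityʳ R))))

opaque
  bounded : ∀ {s} → IsCauchy s → ∃ λ N → ∃ λ B → 0ℚ < B × (∀ n → N ℕ.≤ n → ∣ s n ∣ ≤ B)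
  bounded {s} c with c 1ℚ (positive⁻¹ 1ℚ)
  ... | N , h = N , 1ℚ + ∣ s N ∣ , +-mono-<-≤ (positive⁻¹ 1ℚ) (0≤∣p∣ (s N)) , λ n l →
      ≤-trans (subst (λ z → ∣ z ∣ ≤ ∣ s n - s N ∣ + ∣ s N ∣) (solve 2 (λ a b → (a :- b) :+ b := a) refl (s n) (s N))
                 (∣p+q∣≤∣p∣+∣q∣ (s n - s N) (s N)))
        (+-monoˡ-≤ ∣ s N ∣ (<⇒≤ (h n N l ℕₚ.≤-refl)))

opaque
  const-cauchy : ∀ p → IsCauchy (λ _ → p)
  const-cauchy p ε ε>0 = 0 , λ _ _ _ _ → subst (_< ε) (cong ∣_∣ (sym (+-inverseʳ p))) ε>0

  neg-cauchy : ∀ {s} → IsCauchy s → IsCauchy (λ n → - s n)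
  neg-cauchy {s} c ε ε>0 with c ε ε>0
  ... | N , h = N , λ m n l l′ → subst (_< ε)
    (trans (∣-∣-sym (s m) (s n)) (cong ∣_∣ (solve 2 (λ a b → b :- a := (:- a) :- (:- b)) refl (s m) (s n)))) (h m n l l′)

  +-cauchy : ∀ {s t} → IsCauchy s → IsCauchy t → IsCauchy (λ n → s n + t n)
  +-cauchy {s} {t} c d ε ε>0 with c (½ * ε) (half>0 ε>0) | d (½ * ε) (half>0 ε>0)
  ... | N , h | M , k = N ℕ.⊔ M , λ m n l l′ → ≤-<-trans
      (subst (λ z → ∣ z ∣ ≤ ∣ s m - s n ∣ + ∣ t m - t n ∣)
        (solve 4 (λ a b c d → (a :- b) :+ (c :- d) := (a :+ c) :- (b :+ d)) refl (s m) (s n) (t m) (t n))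
        (∣p+q∣≤∣p∣+∣q∣ (s m - s n) (t m - t n)))
      (subst (∣ s m - s n ∣ + ∣ t m - t n ∣ <_) (half+half ε)
        (+-mono-< (h m n (ℕₚ.m⊔n≤o⇒m≤o N M l) (ℕₚ.m⊔n≤o⇒m≤o N M l′)) (k m n (ℕₚ.m⊔n≤o⇒n≤o N M l) (ℕₚ.m⊔n≤o⇒n≤o N M l′))))

  div-bound : ∀ B ε → 0ℚ < B → 0ℚ < ε → ∃ λ δ → 0ℚ < δ × B * δ ≡ ε
  div-bound B ε B>0 ε>0 = let instance nz = pos⇒nonZero B {{positive B>0}} in
    (1/ B) * ε , 0<* (positive⁻¹ (1/ B) {{1/pos⇒pos B {{positive B>0}}}}) ε>0 ,
    trans (sym (*-assoc B (1/ B) ε)) (trans (cong (_* ε) (*-inverseʳ B)) (*-identityˡ ε))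

opaque
  *-close : ∀ s s′ t t′ B D δ η ε → 0ℚ < B → 0ℚ < D → B * δ ≡ ½ * ε → D * η ≡ ½ * ε →
    ∣ s ∣ ≤ B → ∣ t′ ∣ ≤ D → ∣ t - t′ ∣ < δ → ∣ s - s′ ∣ < η → ∣ s * t - s′ * t′ ∣ < ε
  *-close s s′ t t′ B D δ η ε B>0 D>0 eδ eη hs ht dt ds = ≤-<-trans
      (subst (λ z → ∣ z ∣ ≤ ∣ s * (t - t′) ∣ + ∣ t′ * (s - s′) ∣)
        (solve 4 (λ a b x y → a :* (x :- y) :+ y :* (a :- b) := a :* x :- b :* y) refl s s′ t t′)
        (∣p+q∣≤∣p∣+∣q∣ (s * (t - t′)) (t′ * (s - s′))))
      (subst (∣ s * (t - t′) ∣ + ∣ t′ * (s - s′) ∣ <_) (half+half ε)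
        (+-mono-< (prod s (t - t′) B δ B>0 eδ hs dt) (prod t′ (s - s′) D η D>0 eη ht ds)))
    where
    prod : ∀ a b B δ → 0ℚ < B → B * δ ≡ ½ * ε → ∣ a ∣ ≤ B → ∣ b ∣ < δ → ∣ a * b ∣ < ½ * ε
    prod a b B δ B>0 e ha hb = subst₂ _<_ (sym (∣p*q∣≡∣p∣*∣q∣ a b)) e
      (≤-<-trans (*-monoʳ ∣ b ∣ (0≤∣p∣ b) ha) (*-monoʳ-<-pos B {{positive B>0}} hb))

opaque
  *-cauchy : ∀ {s t} → IsCauchy s → IsCauchy t → IsCauchy (λ n → s n * t n)
  *-cauchy {s} {t} c d ε ε>0 =
    let N₁ , B , B>0 , hB = bounded {s} c
        N₂ , D , D>0 , hD = bounded {t} d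
        δ , δ>0 , eδ = div-bound B (½ * ε) B>0 (half>0 ε>0)
        η , η>0 , eη = div-bound D (½ * ε) D>0 (half>0 ε>0)
        N₃ , h = d δ δ>0
        N₄ , k = c η η>0
        N₁₂ = N₁ ℕ.⊔ N₂
        N₃₄ = N₃ ℕ.⊔ N₄
    in N₁₂ ℕ.⊔ N₃₄ , λ m n l l′ →
      let L  = ℕₚ.m⊔n≤o⇒m≤o N₁₂ N₃₄ l
          L′ = ℕₚ.m⊔n≤o⇒m≤o N₁₂ N₃₄ l′
          R  = ℕₚ.m⊔n≤o⇒n≤o N₁₂ N₃₄ l
          R′ = ℕₚ.m⊔n≤o⇒n≤o N₁₂ N₃₄ l′
      in *-close (s m) (s n) (t m) (t n) B D δ η ε B>0 D>0 eδ eη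
           (hB m (ℕₚ.m⊔n≤o⇒m≤o N₁ N₂ L)) (hD n (ℕₚ.m⊔n≤o⇒n≤o N₁ N₂ L′))
           (h m n (ℕₚ.m⊔n≤o⇒m≤o N₃ N₄ R) (ℕₚ.m⊔n≤o⇒m≤o N₃ N₄ R′))
           (k m n (ℕₚ.m⊔n≤o⇒n≤o N₃ N₄ R) (ℕₚ.m⊔n≤o⇒n≤o N₃ N₄ R′))

opaque
  riemann-close : ∀ p q B ε m n → 0ℚ ≤ B → ∣ q ∣ ≤ B → ∣ p - q ∣ < ½ * ε →
    (B * B) * (+ 1 / suc m) < ½ * (½ * ε) → (B * B) * (+ 1 / suc n) < ½ * (½ * ε) →
    ∣ riemann 1/1+sq p m - riemann 1/1+sq q n ∣ < ε
  riemann-close p q B ε m n B≥0 hq d hm hn = ≤-<-trans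
      (∣-∣-tri (riemann 1/1+sq p m) (riemann 1/1+sq q m) (riemann 1/1+sq q n))
      (subst (∣ riemann 1/1+sq p m - riemann 1/1+sq q m ∣ + ∣ riemann 1/1+sq q m - riemann 1/1+sq q n ∣ <_) (half+half ε)
        (+-mono-< (≤-<-trans (riemann-lipschitz p q m) d)
          (≤-<-trans (refine⇒close (riemann 1/1+sq q) (B * B)
               (λ n′ m′ → ≤-trans (riemann-refine q n′ m′)
                  (*-monoʳ (+ 1 / suc n′) (recip≥0 n′) (*-mono (0≤∣p∣ q) B≥0 hq hq))) m n)
            (subst ((B * B) * (+ 1 / suc m) + (B * B) * (+ 1 / suc n) <_) (half+half (½ * ε)) (+-mono-< hm hn)))))

opaque
  arctan-cauchy : ∀ {s} → IsCauchy s → IsCauchy (λ n → riemann 1/1+sq (s n) n)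
  arctan-cauchy {s} c ε ε>0 =
    let N₁ , B , B>0 , hB = bounded {s} c
        N₂ , h = c (½ * ε) (half>0 ε>0)
        N₃ , small = archimedean (B * B) (½ * (½ * ε)) (half>0 (half>0 ε>0))
        N₂₃ = N₂ ℕ.⊔ N₃
    in N₁ ℕ.⊔ N₂₃ , λ m n l l′ →
      let R  = ℕₚ.m⊔n≤o⇒n≤o N₁ N₂₃ l
          R′ = ℕₚ.m⊔n≤o⇒n≤o N₁ N₂₃ l′
      in riemann-close (s m) (s n) B ε m n (<⇒≤ B>0) (hB n (ℕₚ.m⊔n≤o⇒m≤o N₁ N₂₃ l′))
           (h m n (ℕₚ.m⊔n≤o⇒m≤o N₂ N₃ R) (ℕₚ.m⊔n≤o⇒m≤o N₂ N₃ R′))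
           (small m (ℕₚ.m⊔n≤o⇒n≤o N₂ N₃ R)) (small n (ℕₚ.m⊔n≤o⇒n≤o N₂ N₃ R′))

-- The reals as Cauchy sequences of rationals, up to _≈_.
record ℝ : Set where
  constructor mkℝ
  field
    seq    : ℕ → ℚ
    cauchy : IsCauchy seq
open ℝ public

infix  4 _≈_
infix  8 -ᴿ_
infixl 7 _*ᴿ_
infixl 6 _+ᴿ_ _-ᴿ_
infixr 8 _^ᴿ_

_≈_ : ℝ → ℝ → Set
x ≈ y = ∀ ε → 0ℚ < ε → ∃ λ N → ∀ n → N ℕ.≤ n → ∣ seq x n - seq y n ∣ < ε

fromℚ : ℚ → ℝ
fromℚ p = mkℝ (λ _ → p) (const-cauchy p)

fromℕ : ℕ → ℝ
fromℕ n = fromℚ (ι n)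

-ᴿ_ : ℝ → ℝ
-ᴿ x = mkℝ (λ n → - seq x n) (neg-cauchy {seq x} (cauchy x))

_+ᴿ_ : ℝ → ℝ → ℝ
x +ᴿ y = mkℝ (λ n → seq x n + seq y n) (+-cauchy {seq x} {seq y} (cauchy x) (cauchy y))

_-ᴿ_ : ℝ → ℝ → ℝ
x -ᴿ y = x +ᴿ (-ᴿ y)

_*ᴿ_ : ℝ → ℝ → ℝ
x *ᴿ y = mkℝ (λ n → seq x n * seq y n) (*-cauchy {seq x} {seq y} (cauchy x) (cauchy y))

_^ᴿ_ : ℝ → ℕ → ℝ
x ^ᴿ zero  = fromℕ 1
x ^ᴿ suc n = x *ᴿ (x ^ᴿ n)

½ᴿ : ℝ
½ᴿ = fromℚ ½

√ : ℕ → ℝ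
√ a = mkℝ (√seq a) (refine⇒cauchy (√seq a) 1ℚ (√seq-refine a))

φ : ℝ
φ = (fromℕ 1 +ᴿ √ 5) *ᴿ ½ᴿ

-- π is the area of the unit disc, four times that of its first quadrant.
π : ℝ
π = fromℕ 4 *ᴿ mkℝ quarterDisc (refine⇒cauchy quarterDisc (1ℚ + 1ℚ) quarterDisc-refine)

-- arctan x = ∫₀ˣ dt / (1 + t²): the n-th approximation is the Riemann sum on
-- suc n subintervals up to the n-th approximation of x.
arctan : ℝ → ℝ
arctan x = mkℝ (λ n → riemann 1/1+sq (seq x n) n) (arctan-cauchy {seq x} (cauchy x))

lucas : ℕ → ℕ
lucas 0             = 2
lucas 1             = 1
lucas (suc (suc n)) = lucas (suc n) ℕ.+ lucas n

{-# OPTIONS --safe #-}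
-- With 1/1+sq decreasing on [0, ∞) and the circle's height decreasing on [0, 1],
-- lower sums over one partition are at most upper sums over any other, so each
-- of arctan and the quarter disc may be computed over a convenient partition, with
-- error O(1/N) for N cells.
--   * The quarter disc is cut at the abscissae X(s) = 2s/(1 + s²), s = j/N; with
--     ordinate Y, Y dX is d(XY)/2 plus an infinitesimal triangle of area ds/(1 + s²),
--     whence π/4 = arctan 1.
--   * For τ(x) = (x − 1/x)/2 one has dτ/(1 + τ²) = 2 dx/(1 + x²), whence
--     2 arctan x − arctan τ(x) = 2 arctan 1 = π/2 for x ≥ 1.
-- Finally x = φ^(2k+1) satisfies x² = L x + 1, that is τ(x) = L/2; the rational
-- approximants of φ satisfy this with an error O(1/N).
module Submission where

open import Defs
open import Data.Nat using (ℕ)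

module Estimates where

  open import Data.Nat as ℕ using (zero; suc)
  import Data.Nat.Properties as ℕₚ
  open import Data.Integer using (+_)
  open import Data.Product using (Σ; _,_)
  open import Data.Rational hiding (_≃_)
  open import Data.Rational.Properties
  open import Data.Rational.Solver using (module +-*-Solver)
  open +-*-Solver using (solve; _:+_; _:*_; _:-_; :-_; _:=_; con)
  open import Data.Sum using (inj₁; inj₂)
  open import Relation.Binary.PropositionalEquality

  -- Step sums over two partitions

  ∑-mono : ∀ n {f g : ℕ → ℚ} → (∀ i → i ℕ.< n → f i ≤ g i) → ∑ n f ≤ ∑ n g
  ∑-mono zero    h = ≤-refl
  ∑-mono (suc n) h = +-mono-≤ (∑-mono n λ i l → h i (ℕₚ.m<n⇒m<1+n l)) (h n ℕₚ.≤-refl)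

  ∑-+ : ∀ n (f g : ℕ → ℚ) → ∑ n (λ i → f i + g i) ≡ ∑ n f + ∑ n g
  ∑-+ zero    f g = refl
  ∑-+ (suc n) f g = trans (cong (_+ (f n + g n)) (∑-+ n f g))
    (solve 4 (λ a b c d → (a :+ b) :+ (c :+ d) := (a :+ c) :+ (b :+ d)) refl (∑ n f) (∑ n g) (f n) (g n))

  ∑-zero : ∀ n → ∑ n (λ _ → 0ℚ) ≡ 0ℚ
  ∑-zero zero    = refl
  ∑-zero (suc n) = trans (+-identityʳ _) (∑-zero n)

  ∑-swap : ∀ n m (h : ℕ → ℕ → ℚ) → ∑ n (λ i → ∑ m (h i)) ≡ ∑ m (λ j → ∑ n (λ i → h i j))
  ∑-swap zero    m h = sym (∑-zero m)
  ∑-swap (suc n) m h = trans (cong (_+ ∑ m (h n)) (∑-swap n m h)) (sym (∑-+ m (λ j → ∑ n (λ i → h i j)) (h n)))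

  ∑-increments : ∀ n (p : ℕ → ℚ) → ∑ n (λ i → p (suc i) - p i) ≡ p n - p 0
  ∑-increments zero    p = sym (+-inverseʳ (p 0))
  ∑-increments (suc n) p = trans (cong (_+ (p (suc n) - p n)) (∑-increments n p))
    (solve 3 (λ a b c → (b :- a) :+ (c :- b) := c :- a) refl (p 0) (p n) (p (suc n)))

  Increasing : ℕ → (ℕ → ℚ) → Set
  Increasing n p = ∀ i → i ℕ.< n → p i ≤ p (suc i)

  increasing⇒lower : ∀ n (p : ℕ → ℚ) → Increasing n p → ∀ i → i ℕ.≤ n → p 0 ≤ p i
  increasing⇒lower n p inc zero    l = ≤-refl
  increasing⇒lower n p inc (suc i) l = ≤-trans (increasing⇒lower n p inc i (ℕₚ.<⇒≤ l)) (inc i l)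

  increasing⇒upper : ∀ n (p : ℕ → ℚ) → Increasing n p → ∀ i → i ℕ.≤ n → p i ≤ p n
  increasing⇒upper zero    p inc zero ℕ.z≤n = ≤-refl
  increasing⇒upper (suc n) p inc i l with ℕₚ.m≤n⇒m<n∨m≡n l
  ... | inj₁ l′   = ≤-trans (increasing⇒upper n p (λ j k → inc j (ℕₚ.m<n⇒m<1+n k)) i (ℕₚ.≤-pred l′)) (inc n ℕₚ.≤-refl)
  ... | inj₂ refl = ≤-refl

  -- the length of [a, a′] ∩ [b, b′]
  common : ℚ → ℚ → ℚ → ℚ → ℚ
  common a a′ b b′ = (a′ ⊓ b′ - a′ ⊓ b) - (a ⊓ b′ - a ⊓ b)

  common-comm : ∀ a a′ b b′ → common a a′ b b′ ≡ common b b′ a a′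
  common-comm a a′ b b′ = trans
    (cong₂ _-_ (cong₂ _-_ (⊓-comm a′ b′) (⊓-comm a′ b)) (cong₂ _-_ (⊓-comm a b′) (⊓-comm a b)))
    (solve 4 (λ x y z w → (x :- y) :- (z :- w) := (x :- z) :- (y :- w)) refl (b′ ⊓ a′) (b ⊓ a′) (b′ ⊓ a) (b ⊓ a))

  ⊓-gap≥0 : ∀ a {b b′} → b ≤ b′ → 0ℚ ≤ a ⊓ b′ - a ⊓ b
  ⊓-gap≥0 a h = ≤⇒0≤ (⊓-monoʳ-≤ a h)

  ⊓-gap-above : ∀ a b b′ → b ≤ b′ → b′ ≤ a → a ⊓ b′ - a ⊓ b ≡ b′ - b
  ⊓-gap-above a b b′ h k = cong₂ _-_ (p≥q⇒p⊓q≡q k) (p≥q⇒p⊓q≡q (≤-trans h k))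

  ⊓-gap-below : ∀ a b b′ → b ≤ b′ → a ≤ b → a ⊓ b′ - a ⊓ b ≡ 0ℚ
  ⊓-gap-below a b b′ h k = trans (cong₂ _-_ (p≤q⇒p⊓q≡p (≤-trans k h)) (p≤q⇒p⊓q≡p k)) (+-inverseʳ a)

  -- If a ≤ b, capping at a makes the subtracted term vanish, and what is left is the increment of a
  -- monotone function. If b ≤ a, the two intervals exchange roles.
  0≤common : ∀ {a a′ b b′} → a ≤ a′ → b ≤ b′ → 0ℚ ≤ common a a′ b b′
  0≤common {a} {a′} {b} {b′} h k with ≤-total a b
  ... | inj₁ a≤b = subst (λ z → 0ℚ ≤ (a′ ⊓ b′ - a′ ⊓ b) - z) (sym (⊓-gap-below a b b′ k a≤b))
    (subst (0ℚ ≤_) (sym (+-identityʳ _)) (⊓-gap≥0 a′ k))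
  ... | inj₂ b≤a = subst (0ℚ ≤_) (sym (common-comm a a′ b b′))
    (subst (λ z → 0ℚ ≤ (b′ ⊓ a′ - b′ ⊓ a) - z) (sym (⊓-gap-below b a a′ h b≤a))
      (subst (0ℚ ≤_) (sym (+-identityʳ _)) (⊓-gap≥0 b′ h)))

  common-disjoint : ∀ {a a′ b b′} → a ≤ a′ → b ≤ b′ → b′ ≤ a → common a a′ b b′ ≡ 0ℚ
  common-disjoint {a} {a′} {b} {b′} h k l = trans
    (cong₂ _-_ (⊓-gap-above a′ b b′ k (≤-trans l h)) (⊓-gap-above a b b′ k l)) (+-inverseʳ (b′ - b))

  -- Disjoint cells carry weight 0, so the values have to be compared only where the cells meet.
  common-weigh : ∀ {a a′ b b′ v w} → a ≤ a′ → b ≤ b′ → (a ≤ b′ → b ≤ a′ → v ≤ w) →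
    v * common a a′ b b′ ≤ w * common a a′ b b′
  common-weigh {a} {a′} {b} {b′} {v} {w} h k cmp with ≤-total b′ a | ≤-total a′ b
  ... | inj₁ l | _      = ≤-reflexive (trans (vanish v) (sym (vanish w)))
    where
    vanish : ∀ x → x * common a a′ b b′ ≡ 0ℚ
    vanish x = trans (cong (x *_) (common-disjoint h k l)) (*-zeroʳ x)
  ... | inj₂ _ | inj₁ l = ≤-reflexive (trans (vanish v) (sym (vanish w)))
    where
    vanish : ∀ x → x * common a a′ b b′ ≡ 0ℚ
    vanish x = trans (cong (x *_) (trans (common-comm a a′ b b′) (common-disjoint k h l))) (*-zeroʳ x)
  ... | inj₂ l | inj₂ r = *-monoʳ (common a a′ b b′) (0≤common h k) (cmp l r)

  -- By its definition `common` is an increment in its first interval, so the sum telescopes; of the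
  -- two end terms, the one at c 0 vanishes and the one at c n is the full length.
  ∑-common : ∀ n (c : ℕ → ℚ) b b′ → c 0 ≤ b → b ≤ b′ → b′ ≤ c n →
    ∑ n (λ i → common (c i) (c (suc i)) b b′) ≡ b′ - b
  ∑-common n c b b′ l h u = trans (∑-increments n (λ i → c i ⊓ b′ - c i ⊓ b))
    (trans (cong₂ _-_ (⊓-gap-above (c n) b b′ h u) (⊓-gap-below (c 0) b b′ h l)) (+-identityʳ (b′ - b)))

  -- Both sums are double sums over pairs of cells, weighted by the common length.
  step-sum-≤ : ∀ n m (c p h v : ℕ → ℚ) → Increasing n c → Increasing m p → c 0 ≡ p 0 → c n ≡ p m →
    (∀ i j → i ℕ.< n → j ℕ.< m → c i ≤ p (suc j) → p j ≤ c (suc i) → v j ≤ h i) →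
    ∑ m (λ j → v j * (p (suc j) - p j)) ≤ ∑ n (λ i → h i * (c (suc i) - c i))
  step-sum-≤ n m c p h v inc-c inc-p start end cmp = subst₂ _≤_
      (trans (∑-swap n m (λ i j → v j * ov i j))
        (∑-cong m λ j l → trans (∑-* n (λ i → ov i j) (v j)) (cong (v j *_)
          (∑-common n c (p j) (p (suc j))
            (subst (_≤ p j) (sym start) (increasing⇒lower m p inc-p j (ℕₚ.<⇒≤ l)))
            (inc-p j l)
            (subst (p (suc j) ≤_) (sym end) (increasing⇒upper m p inc-p (suc j) l))))))
      (∑-cong n λ i l → trans (∑-* m (ov i) (h i)) (cong (h i *_)
        (trans (∑-cong m λ j _ → common-comm (c i) (c (suc i)) (p j) (p (suc j)))
          (∑-common m p (c i) (c (suc i))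
            (subst (_≤ c i) start (increasing⇒lower n c inc-c i (ℕₚ.<⇒≤ l)))
            (inc-c i l)
            (subst (c (suc i) ≤_) end (increasing⇒upper n c inc-c (suc i) l))))))
      (∑-mono n λ i l → ∑-mono m λ j k → common-weigh (inc-c i l) (inc-p j k) (cmp i j l k))
    where
    ov : ℕ → ℕ → ℚ
    ov i j = common (c i) (c (suc i)) (p j) (p (suc j))

  -- Riemann sums of 1/(1 + t²)

  leftSum rightSum : (ℚ → ℚ) → (ℕ → ℚ) → ℕ → ℚ
  leftSum  F p m = ∑ m λ j → F (p j) * (p (suc j) - p j)
  rightSum F p m = ∑ m λ j → F (p (suc j)) * (p (suc j) - p j)

  uniform : ℚ → ℚ → ℕ → ℚ
  uniform a e k = a + ι k * e

  uniform-zero : ∀ a e → uniform a e 0 ≡ a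
  uniform-zero a e = trans (cong (λ z → a + z) (*-zeroˡ e)) (+-identityʳ a)

  uniform-suc : ∀ a e k → uniform a e (suc k) ≡ uniform a e k + e
  uniform-suc a e k = trans (cong (λ z → a + z * e) (ι-+ 1 k))
    (solve 3 (λ a e k → a :+ (con 1ℚ :+ k) :* e := (a :+ k :* e) :+ e) refl a e (ι k))

  uniform-increment : ∀ a e k → uniform a e (suc k) - uniform a e k ≡ e
  uniform-increment a e k = trans (cong (_- uniform a e k) (uniform-suc a e k))
    (solve 2 (λ u e → (u :+ e) :- u := e) refl (uniform a e k) e)

  uniform-end : ∀ a w n → uniform a (w * (+ 1 / suc n)) (suc n) ≡ a + w
  uniform-end a w n = cong (λ z → a + z) (trans
    (solve 3 (λ i w r → i :* (w :* r) := w :* (i :* r)) refl (ι (suc n)) w (+ 1 / suc n))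
    (trans (cong (w *_) (ι*recip n)) (*-identityʳ w)))

  uniform-increasing : ∀ a {e} → 0ℚ ≤ e → ∀ m → Increasing m (uniform a e)
  uniform-increasing a {e} h m i _ = 0≤⇒≤ (subst (0ℚ ≤_) (sym (uniform-increment a e i)) h)

  leftSum-uniform : ∀ F a e m → leftSum F (uniform a e) m ≡ ∑ m (λ j → F (uniform a e j) * e)
  leftSum-uniform F a e m = ∑-cong m λ j _ → cong (F (uniform a e j) *_) (uniform-increment a e j)

  -- On a uniform mesh the two sums share every value of F except the first and the last.
  leftSum-rightSum : ∀ F a e m →
    leftSum F (uniform a e) m ≡ rightSum F (uniform a e) m + (F (uniform a e 0) - F (uniform a e m)) * e
  leftSum-rightSum F a e zero    = solve 2 (λ u e → con 0ℚ := con 0ℚ :+ (u :- u) :* e) refl (F (uniform a e 0)) e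
  leftSum-rightSum F a e (suc m) = trans
    (cong₂ (λ x d → x + F (uniform a e m) * d) (leftSum-rightSum F a e m) (uniform-increment a e m))
    (trans (solve 5 (λ r u v w e → (r :+ (u :- v) :* e) :+ v :* e := (r :+ w :* e) :+ (u :- w) :* e) refl
             (rightSum F (uniform a e) m) (F (uniform a e 0)) (F (uniform a e m)) (F (uniform a e (suc m))) e)
      (cong (λ d → (rightSum F (uniform a e) m + F (uniform a e (suc m)) * d) + (F (uniform a e 0) - F (uniform a e (suc m))) * e)
        (sym (uniform-increment a e m))))

  -- 1/(1 + a²) - 1/(1 + b²) = (b - a)(b + a)/((1 + a²)(1 + b²)).
  1/1+sq-antitone : ∀ {a b} → 0ℚ ≤ a → a ≤ b → 1/1+sq b ≤ 1/1+sq a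
  1/1+sq-antitone {a} {b} h k = 0≤⇒≤ (subst (0ℚ ≤_) eq
      (0≤* (0≤* (≤⇒0≤ k) (0≤+ (≤-trans h k) h)) (0≤* (1/1+sq≥0 a) (1/1+sq≥0 b))))
    where
    X Y : ℚ
    X = 1/1+sq a
    Y = 1/1+sq b
    eq : (b - a) * (b + a) * (X * Y) ≡ X - Y
    eq = trans (solve 4 (λ a b x y → (b :- a) :* (b :+ a) :* (x :* y)
                 := x :* (y :* (con 1ℚ :+ b :* b)) :- y :* (x :* (con 1ℚ :+ a :* a))) refl a b X Y)
          (trans (cong₂ (λ u v → X * u - Y * v) (1/1+sq-inverse b) (1/1+sq-inverse a))
            (cong₂ _-_ (*-identityʳ X) (*-identityʳ Y)))

  1/1+sq≤1 : ∀ a → 1/1+sq a ≤ 1ℚ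
  1/1+sq≤1 a = 0≤⇒≤ (subst (0ℚ ≤_) eq (0≤* (1/1+sq≥0 a) (0≤sq a)))
    where
    eq : 1/1+sq a * (a * a) ≡ 1ℚ - 1/1+sq a
    eq = trans (solve 2 (λ a x → x :* (a :* a) := x :* (con 1ℚ :+ a :* a) :- x) refl a (1/1+sq a))
      (cong (_- 1/1+sq a) (1/1+sq-inverse a))

  -- For a decreasing integrand the right sum is a lower sum and the left sum an upper sum. Where
  -- cells meet, the left end of the one is at most the right end of the other.
  rightSum≤leftSum : ∀ n m (c p : ℕ → ℚ) → Increasing n c → Increasing m p → 0ℚ ≤ c 0 → c 0 ≡ p 0 → c n ≡ p m →
    rightSum 1/1+sq p m ≤ leftSum 1/1+sq c n
  rightSum≤leftSum n m c p inc-c inc-p 0≤c start end = step-sum-≤ n m c p (λ i → 1/1+sq (c i)) (λ j → 1/1+sq (p (suc j)))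
    inc-c inc-p start end
    λ i j l _ h _ → 1/1+sq-antitone (≤-trans 0≤c (increasing⇒lower n c inc-c i (ℕₚ.<⇒≤ l))) h

  riemann-leftSum : ∀ F b n → riemann F b n ≡ leftSum F (uniform 0ℚ (b * (+ 1 / suc n))) (suc n)
  riemann-leftSum F b n = trans
    (∑-cong (suc n) λ i _ → cong (λ z → F z * (b * R)) (trans (cong (_* b) (frac i n))
      (solve 3 (λ i r b → i :* r :* b := con 0ℚ :+ i :* (b :* r)) refl (ι i) R b)))
    (sym (leftSum-uniform F 0ℚ (b * R) (suc n)))
    where
    R : ℚ
    R = + 1 / suc n

  module _ (b : ℚ) (n : ℕ) (0≤b : 0ℚ ≤ b) (p : ℕ → ℚ) (m : ℕ) (inc : Increasing m p) (start : p 0 ≡ 0ℚ) (end : p m ≡ b) where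
    private
      R : ℚ
      R = + 1 / suc n
      c : ℕ → ℚ
      c = uniform 0ℚ (b * R)
      inc-c : Increasing (suc n) c
      inc-c = uniform-increasing 0ℚ (0≤* 0≤b (recip≥0 n)) (suc n)
      c-start : c 0 ≡ 0ℚ
      c-start = uniform-zero 0ℚ (b * R)
      c-end : c (suc n) ≡ b
      c-end = trans (uniform-end 0ℚ b n) (+-identityˡ b)

    rightSum≤riemann : rightSum 1/1+sq p m ≤ riemann 1/1+sq b n
    rightSum≤riemann = subst (rightSum 1/1+sq p m ≤_) (sym (riemann-leftSum 1/1+sq b n))
      (rightSum≤leftSum (suc n) m c p inc-c inc (≤-reflexive (sym c-start)) (trans c-start (sym start)) (trans c-end (sym end)))

    -- `riemann` is itself an upper sum, so it is first traded for the right sum on its own mesh.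
    -- The cost is the drop of the integrand over [0, b], at most 1, times the mesh b/N.
    riemann≤leftSum : riemann 1/1+sq b n ≤ leftSum 1/1+sq p m + b * R
    riemann≤leftSum = subst (_≤ leftSum 1/1+sq p m + b * R)
      (sym (trans (riemann-leftSum 1/1+sq b n) (leftSum-rightSum 1/1+sq 0ℚ (b * R) (suc n))))
      (+-mono-≤
        (rightSum≤leftSum m (suc n) p c inc inc-c (≤-reflexive (sym start)) (trans start (sym c-start)) (trans end (sym c-end)))
        (subst ((1/1+sq (c 0) - 1/1+sq (c (suc n))) * (b * R) ≤_) (*-identityˡ (b * R))
          (*-monoʳ {1/1+sq (c 0) - 1/1+sq (c (suc n))} {1ℚ} (b * R) (0≤* 0≤b (recip≥0 n))
            (0≤⇒≤ {1/1+sq (c 0) - 1/1+sq (c (suc n))} {1ℚ} (subst (0ℚ ≤_) (solve 2 (λ x y → (con 1ℚ :- x) :+ y := con 1ℚ :- (x :- y)) refl (1/1+sq (c 0)) (1/1+sq (c (suc n))))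
              (0≤+ (≤⇒0≤ (1/1+sq≤1 (c 0))) (1/1+sq≥0 (c (suc n)))))))))

  -- p 0, …, p N, q 1, q 2, … when p N = q 0
  concat : ℕ → (ℕ → ℚ) → (ℕ → ℚ) → ℕ → ℚ
  concat N p q k = p (k ℕ.⊓ N) + (q (k ℕ.∸ N) - q 0)

  concat-left : ∀ N p q k → k ℕ.≤ N → concat N p q k ≡ p k
  concat-left N p q k l = trans
    (cong₂ (λ i j → p i + (q j - q 0)) (ℕₚ.m≤n⇒m⊓n≡m l) (ℕₚ.m≤n⇒m∸n≡0 l))
    (solve 2 (λ p q → p :+ (q :- q) := p) refl (p k) (q 0))

  concat-right : ∀ N p q → p N ≡ q 0 → ∀ i → concat N p q (N ℕ.+ i) ≡ q i
  concat-right N p q e i = trans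
    (cong₂ (λ i j → p i + (q j - q 0)) (ℕₚ.m≥n⇒m⊓n≡n (ℕₚ.m≤m+n N i)) (ℕₚ.m+n∸m≡n N i))
    (trans (cong (_+ (q i - q 0)) e) (solve 2 (λ a b → a :+ (b :- a) := b) refl (q 0) (q i)))

  concat-right-suc : ∀ N p q → p N ≡ q 0 → ∀ i → concat N p q (suc (N ℕ.+ i)) ≡ q (suc i)
  concat-right-suc N p q e i = trans (cong (concat N p q) (sym (ℕₚ.+-suc N i))) (concat-right N p q e (suc i))

  -- Since T takes both ends of a cell, this serves left and right sums alike.
  ∑-concat : ∀ (T : ℚ → ℚ → ℚ) N M p q → p N ≡ q 0 →
    ∑ (N ℕ.+ M) (λ k → T (concat N p q k) (concat N p q (suc k)))
      ≡ ∑ N (λ k → T (p k) (p (suc k))) + ∑ M (λ k → T (q k) (q (suc k)))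
  ∑-concat T N M p q e = trans (∑-add N M (λ k → T (concat N p q k) (concat N p q (suc k)))) (cong₂ _+_
    (∑-cong N λ i l → cong₂ T (concat-left N p q i (ℕₚ.<⇒≤ l)) (concat-left N p q (suc i) l))
    (∑-cong M λ i _ → cong₂ T (concat-right N p q e i) (concat-right-suc N p q e i)))

  concat-increasing : ∀ N M p q → p N ≡ q 0 → Increasing N p → Increasing M q → Increasing (N ℕ.+ M) (concat N p q)
  concat-increasing N M p q e inc-p inc-q k l with ℕₚ.≤-total N k
  ... | inj₁ N≤k with ℕₚ.m≤n⇒∃[o]m+o≡n N≤k
  ...   | i , refl = subst₂ _≤_ (sym (concat-right N p q e i)) (sym (concat-right-suc N p q e i))
            (inc-q i (ℕₚ.+-cancelˡ-< N i M l))
  concat-increasing N M p q e inc-p inc-q k l | inj₂ k≤N with ℕₚ.m≤n⇒m<n∨m≡n k≤N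
  ... | inj₁ k<N  = subst₂ _≤_ (sym (concat-left N p q k k≤N)) (sym (concat-left N p q (suc k) k<N)) (inc-p k k<N)
  -- The cell at the joint runs from p N = q 0 to q 1; that q has a first cell follows from N < N +
  -- M.
  ... | inj₂ refl = subst₂ _≤_ (sym (concat-left N p q N k≤N))
          (sym (trans (cong (λ z → concat N p q (suc z)) (sym (ℕₚ.+-identityʳ N))) (concat-right-suc N p q e 0)))
          (subst (_≤ q 1) (sym e) (inc-q 0 (ℕₚ.+-cancelˡ-< N 0 M (subst (ℕ._< N ℕ.+ M) (sym (ℕₚ.+-identityʳ N)) l))))

  -- The quarter disc

  2ℚ : ℚ
  2ℚ = 1ℚ + 1ℚ

  sq-cancel-≤ : ∀ {p q} → 0ℚ ≤ q → p * p ≤ q * q → p ≤ q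
  sq-cancel-≤ {p} {q} h k = ≮⇒≥ λ q<p → <-irrefl refl
    (≤-<-trans k (≤-<-trans (*-monoˡ q h (<⇒≤ q<p)) (*-monoˡ-<-pos p {{positive (≤-<-trans h q<p)}} q<p)))

  scaled-square : ∀ a n → (+ a / suc n) * (+ a / suc n) ≡ ι (a ℕ.* a) * ((+ 1 / suc n) * (+ 1 / suc n))
  scaled-square a n = trans (cong (λ z → z * z) (frac a n))
    (trans (solve 2 (λ a r → (a :* r) :* (a :* r) := (a :* a) :* (r :* r)) refl (ι a) (+ 1 / suc n))
      (cong (_* ((+ 1 / suc n) * (+ 1 / suc n))) (sym (ι-* a a))))

  scaled-squares : ∀ a b n → (+ a / suc n) * (+ a / suc n) + (+ b / suc n) * (+ b / suc n)
    ≡ ι (a ℕ.* a ℕ.+ b ℕ.* b) * ((+ 1 / suc n) * (+ 1 / suc n))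
  scaled-squares a b n = trans (cong₂ _+_ (scaled-square a n) (scaled-square b n))
    (trans (sym (*-distribʳ-+ ((+ 1 / suc n) * (+ 1 / suc n)) (ι (a ℕ.* a)) (ι (b ℕ.* b))))
      (cong (_* ((+ 1 / suc n) * (+ 1 / suc n))) (sym (ι-+ (a ℕ.* a) (b ℕ.* b)))))

  scaled-unit : ∀ n → ι (suc n ℕ.* suc n) * ((+ 1 / suc n) * (+ 1 / suc n)) ≡ 1ℚ
  scaled-unit n = trans (cong (_* (R * R)) (ι-* (suc n) (suc n)))
    (trans (solve 2 (λ a r → (a :* a) :* (r :* r) := (a :* r) :* (a :* r)) refl (ι (suc n)) R)
      (cong₂ _*_ (ι*recip n) (ι*recip n)))
    where
    R : ℚ
    R = + 1 / suc n

  module _ (n i : ℕ) (i≤N : i ℕ.≤ suc n) where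
    private
      N h : ℕ
      N = suc n
      h = isqrt (N ℕ.* N ℕ.∸ i ℕ.* i)
      R : ℚ
      R = + 1 / suc n
      -- Here `i≤N` ensures that the truncated subtraction is the true one.
      split : N ℕ.* N ℕ.∸ i ℕ.* i ℕ.+ i ℕ.* i ≡ N ℕ.* N
      split = ℕₚ.m∸n+n≡m (ℕₚ.*-mono-≤ i≤N i≤N)
      0≤R² : 0ℚ ≤ R * R
      0≤R² = 0≤sq R

    -- Rounding the root down keeps the point in the disc: `isqrt-lower` divided by N².
    height-inside : height n i * height n i + (+ i / suc n) * (+ i / suc n) ≤ 1ℚ
    height-inside = subst₂ _≤_ (sym (scaled-squares h i n)) (scaled-unit n)
      (*-monoʳ (R * R) 0≤R² (ι-mono-≤ (subst (h ℕ.* h ℕ.+ i ℕ.* i ℕ.≤_) split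
        (ℕₚ.+-monoˡ-≤ (i ℕ.* i) (isqrt-lower (N ℕ.* N ℕ.∸ i ℕ.* i))))))

    -- Raising the point by one mesh takes it out of the open disc: `isqrt-upper` divided by N².
    height-outside : 1ℚ ≤ (height n i + R) * (height n i + R) + (+ i / suc n) * (+ i / suc n)
    height-outside = subst₂ _≤_ (scaled-unit n)
      (trans (sym (scaled-squares (suc h) i n)) (cong (λ z → z * z + (+ i / suc n) * (+ i / suc n)) (frac-suc h n)))
      (*-monoʳ (R * R) 0≤R² (ι-mono-≤ (subst (ℕ._≤ suc h ℕ.* suc h ℕ.+ i ℕ.* i) split
        (ℕₚ.+-monoˡ-≤ (i ℕ.* i) (ℕₚ.<⇒≤ (isqrt-upper (N ℕ.* N ℕ.∸ i ℕ.* i)))))))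

    private
      0≤c : 0ℚ ≤ + i / suc n
      0≤c = subst (0ℚ ≤_) (sym (frac i n)) (0≤* (0≤ι i) (recip≥0 n))
      sum-of-squares-≤ : ∀ {a b c d} → 0ℚ ≤ b → b ≤ d → a * a + d * d ≤ c * c + b * b → 0ℚ ≤ c → a ≤ c
      sum-of-squares-≤ {a} {b} {c} {d} 0≤b b≤d le 0≤c = sq-cancel-≤ 0≤c (0≤⇒≤ {a * a} {c * c} (subst (0ℚ ≤_)
        (solve 4 (λ a b c d → (c :+ b :- (a :+ d)) :+ (d :- b) := c :- a) refl (a * a) (b * b) (c * c) (d * d))
        (0≤+ (≤⇒0≤ le) (≤⇒0≤ (*-mono 0≤b (≤-trans 0≤b b≤d) b≤d b≤d)))))

    height-≤ : ∀ {X Y} → Y * Y + X * X ≡ 1ℚ → 0ℚ ≤ X → 0ℚ ≤ Y → X ≤ + i / suc n → height n i ≤ Y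
    height-≤ {X} {Y} circle 0≤X 0≤Y le =
      sum-of-squares-≤ 0≤X le (subst (height n i * height n i + (+ i / suc n) * (+ i / suc n) ≤_) (sym circle) height-inside) 0≤Y

    height-≥ : ∀ {X Y} → Y * Y + X * X ≡ 1ℚ → + i / suc n ≤ X → Y ≤ height n i + R
    height-≥ circle le = sum-of-squares-≤ 0≤c le (subst (_≤ _) (sym circle) height-outside)
      (0≤+ (subst (0ℚ ≤_) (sym (frac h n)) (0≤* (0≤ι h) (recip≥0 n))) (recip≥0 n))

  -- s ↦ (circleX s , circleY s) = (2s/(1 + s²) , (1 - s²)/(1 + s²))
  circleX circleY : ℚ → ℚ
  circleX s = 2ℚ * (s * 1/1+sq s)
  circleY s = 2ℚ * 1/1+sq s - 1ℚ

  -- Multiples of z - 1 carry a relation z ≡ 1 through the ring solver.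
  *-excess : ∀ c {z} → z ≡ 1ℚ → c * (z - 1ℚ) ≡ 0ℚ
  *-excess c refl = *-zeroʳ c

  circle : ∀ s → circleY s * circleY s + circleX s * circleX s ≡ 1ℚ
  circle s = trans
    (solve 2 (λ s f → (con 2ℚ :* f :- con 1ℚ) :* (con 2ℚ :* f :- con 1ℚ) :+ (con 2ℚ :* (s :* f)) :* (con 2ℚ :* (s :* f))
       := con 1ℚ :+ (con 2ℚ :* con 2ℚ :* f) :* (f :* (con 1ℚ :+ s :* s) :- con 1ℚ)) refl s f)
    (cong (λ z → 1ℚ + z) (*-excess (2ℚ * 2ℚ * f) (1/1+sq-inverse s)))
    where
    f : ℚ
    f = 1/1+sq s

  module _ (s t : ℚ) (0≤s : 0ℚ ≤ s) (s≤t : s ≤ t) (t≤1 : t ≤ 1ℚ) where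
    private
      f g Δ : ℚ
      f = 1/1+sq s
      g = 1/1+sq t
      Δ = circleX t - circleX s
      f-inv : f * (1ℚ + s * s) ≡ 1ℚ
      f-inv = 1/1+sq-inverse s
      g-inv : g * (1ℚ + t * t) ≡ 1ℚ
      g-inv = 1/1+sq-inverse t
      0≤t : 0ℚ ≤ t
      0≤t = ≤-trans 0≤s s≤t
      0≤fg : 0ℚ ≤ f * g
      0≤fg = 0≤* (1/1+sq≥0 s) (1/1+sq≥0 t)

    -- twice the area of the triangle with vertices 0 and the points at s and t
    triangle : ℚ
    triangle = t * g * (2ℚ * f - 1ℚ) - s * f * (2ℚ * g - 1ℚ)

    -- The relations f(1 + s²) = 1 = g(1 + t²) turn `triangle` into (t - s)(1 + st)fg, and 1 + st
    -- lies between 1 + s² and 1 + t². This gives both this bound and `triangle-≥`.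
    triangle-≤ : triangle ≤ f * (t - s)
    triangle-≤ = 0≤⇒≤ {triangle} {f * (t - s)} (subst (0ℚ ≤_) eq (0≤* (0≤sq (t - s)) (0≤* 0≤t 0≤fg)))
      where
      eq : (t - s) * (t - s) * (t * (f * g)) ≡ f * (t - s) - triangle
      eq = trans (solve 4 (λ s t f g → (t :- s) :* (t :- s) :* (t :* (f :* g))
          := (f :* (t :- s) :- (t :* g :* (con 2ℚ :* f :- con 1ℚ) :- s :* f :* (con 2ℚ :* g :- con 1ℚ)))
             :+ ((t :- con 2ℚ :* s) :* f :* (g :* (con 1ℚ :+ t :* t) :- con 1ℚ) :+ t :* g :* (f :* (con 1ℚ :+ s :* s) :- con 1ℚ)))
          refl s t f g)
        (trans (cong₂ (λ u v → (f * (t - s) - triangle) + (u + v)) (*-excess ((t - 2ℚ * s) * f) g-inv) (*-excess (t * g) f-inv))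
          (+-identityʳ (f * (t - s) - triangle)))

    triangle-≥ : g * (t - s) ≤ triangle
    triangle-≥ = 0≤⇒≤ {g * (t - s)} {triangle} (subst (0ℚ ≤_) eq (0≤* (0≤sq (t - s)) (0≤* 0≤s 0≤fg)))
      where
      eq : (t - s) * (t - s) * (s * (f * g)) ≡ triangle - g * (t - s)
      eq = trans (solve 4 (λ s t f g → (t :- s) :* (t :- s) :* (s :* (f :* g))
          := ((t :* g :* (con 2ℚ :* f :- con 1ℚ) :- s :* f :* (con 2ℚ :* g :- con 1ℚ)) :- g :* (t :- s))
             :+ ((s :- con 2ℚ :* t) :* g :* (f :* (con 1ℚ :+ s :* s) :- con 1ℚ) :+ s :* f :* (g :* (con 1ℚ :+ t :* t) :- con 1ℚ)))
          refl s t f g)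
        (trans (cong₂ (λ u v → (triangle - g * (t - s)) + (u + v)) (*-excess ((s - 2ℚ * t) * g) f-inv) (*-excess (s * f) g-inv))
          (+-identityʳ (triangle - g * (t - s))))

    -- The increment is 2(t - s)(1 - st)fg, and st ≤ 1.
    circleX-mono : circleX s ≤ circleX t
    circleX-mono = *-monoˡ 2ℚ (nonNegative⁻¹ 2ℚ) (0≤⇒≤ {s * f} {t * g} (subst (0ℚ ≤_) eq (0≤* (0≤* (≤⇒0≤ s≤t) 0≤1-st) 0≤fg)))
      where
      0≤1-st : 0ℚ ≤ 1ℚ - s * t
      0≤1-st = ≤⇒0≤ (*-mono {s} {1ℚ} {t} {1ℚ} 0≤t (nonNegative⁻¹ 1ℚ) (≤-trans s≤t t≤1) t≤1)
      eq : (t - s) * (1ℚ - s * t) * (f * g) ≡ t * g - s * f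
      eq = trans (solve 4 (λ s t f g → (t :- s) :* (con 1ℚ :- s :* t) :* (f :* g)
          := t :* g :* (f :* (con 1ℚ :+ s :* s)) :- s :* f :* (g :* (con 1ℚ :+ t :* t))) refl s t f g)
        (trans (cong₂ (λ u v → t * g * u - s * f * v) f-inv g-inv)
          (cong₂ _-_ (*-identityʳ (t * g)) (*-identityʳ (s * f))))

    circleX-lipschitz : Δ ≤ 2ℚ * (t - s)
    circleX-lipschitz = subst (_≤ 2ℚ * (t - s))
      (solve 4 (λ s t f g → con 2ℚ :* (t :* g :- s :* f) := con 2ℚ :* (t :* g) :- con 2ℚ :* (s :* f)) refl s t f g)
      (*-monoˡ 2ℚ (nonNegative⁻¹ 2ℚ) (≤-trans (p≤∣p∣ (t * g - s * f))
        (subst₂ _≤_ (cong₂ (λ u v → ∣ t * 1/1+sq u - s * 1/1+sq v ∣) (*-identityˡ t) (*-identityˡ s))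
          (0≤p⇒∣p∣≡p (≤⇒0≤ s≤t)) (term-lipschitz 1ℚ t s))))

    private
      P Q : ℚ
      P = ½ * (circleX t * circleY t)
      Q = ½ * (circleX s * circleY s)
      0≤gap : 0ℚ ≤ (f - g) * (2ℚ * (t - s) - Δ)
      0≤gap = 0≤* (≤⇒0≤ (1/1+sq-antitone 0≤s s≤t)) (≤⇒0≤ circleX-lipschitz)

    -- The trapezoid with the mean of the two ordinates has area `triangle` + P - Q. Taking the
    -- ordinate at s instead adds (f - g)Δ, which is at most 2(t - s)(f - g). The bound is arranged
    -- so that, for a fixed step, the bracket is an increment and telescopes.
    circle-upper : circleY s * Δ ≤ f * (t - s) + ((P - 2ℚ * (t - s) * g) - (Q - 2ℚ * (t - s) * f))
    circle-upper = 0≤⇒≤ {circleY s * Δ} {f * (t - s) + ((P - 2ℚ * (t - s) * g) - (Q - 2ℚ * (t - s) * f))}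
      (subst (0ℚ ≤_) (solve 5 (λ s t f g d →
          (f :* d :- (t :* g :* (con 2ℚ :* f :- con 1ℚ) :- s :* f :* (con 2ℚ :* g :- con 1ℚ)))
            :+ (f :- g) :* (con 2ℚ :* d :- (con 2ℚ :* (t :* g) :- con 2ℚ :* (s :* f)))
          := (f :* d :+ ((con ½ :* ((con 2ℚ :* (t :* g)) :* (con 2ℚ :* g :- con 1ℚ)) :- con 2ℚ :* d :* g)
                         :- (con ½ :* ((con 2ℚ :* (s :* f)) :* (con 2ℚ :* f :- con 1ℚ)) :- con 2ℚ :* d :* f)))
             :- (con 2ℚ :* f :- con 1ℚ) :* (con 2ℚ :* (t :* g) :- con 2ℚ :* (s :* f))) refl s t f g (t - s))
        (0≤+ (≤⇒0≤ triangle-≤) 0≤gap))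

    -- The same trapezoid; the ordinate at t loses (f - g)Δ instead.
    circle-lower : g * (t - s) + ((P + 2ℚ * (t - s) * g) - (Q + 2ℚ * (t - s) * f)) ≤ circleY t * Δ
    circle-lower = 0≤⇒≤ {g * (t - s) + ((P + 2ℚ * (t - s) * g) - (Q + 2ℚ * (t - s) * f))} {circleY t * Δ}
      (subst (0ℚ ≤_) (solve 5 (λ s t f g d →
          ((t :* g :* (con 2ℚ :* f :- con 1ℚ) :- s :* f :* (con 2ℚ :* g :- con 1ℚ)) :- g :* d)
            :+ (f :- g) :* (con 2ℚ :* d :- (con 2ℚ :* (t :* g) :- con 2ℚ :* (s :* f)))
          := (con 2ℚ :* g :- con 1ℚ) :* (con 2ℚ :* (t :* g) :- con 2ℚ :* (s :* f))
            :- (g :* d :+ ((con ½ :* ((con 2ℚ :* (t :* g)) :* (con 2ℚ :* g :- con 1ℚ)) :+ con 2ℚ :* d :* g)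
                         :- (con ½ :* ((con 2ℚ :* (s :* f)) :* (con 2ℚ :* f :- con 1ℚ)) :+ con 2ℚ :* d :* f)))) refl s t f g (t - s))
        (0≤+ (≤⇒0≤ triangle-≥) 0≤gap))

  module _ (n : ℕ) where
    private
      N : ℕ
      N = suc n
      R : ℚ
      R = + 1 / suc n
      s X Y c h : ℕ → ℚ
      s = uniform 0ℚ R
      X j = circleX (s j)
      Y j = circleY (s j)
      c i = + i / suc n
      h = height n

      s-zero : s 0 ≡ 0ℚ
      s-zero = uniform-zero 0ℚ R
      s-end : s N ≡ 1ℚ
      s-end = trans (cong (λ z → 0ℚ + z) (ι*recip n)) (+-identityˡ 1ℚ)
      s-inc : Increasing N s
      s-inc = uniform-increasing 0ℚ (recip≥0 n) N
      0≤s : ∀ j → j ℕ.≤ N → 0ℚ ≤ s j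
      0≤s j l = subst (_≤ s j) s-zero (increasing⇒lower N s s-inc j l)
      s≤1 : ∀ j → j ℕ.≤ N → s j ≤ 1ℚ
      s≤1 j l = subst (s j ≤_) s-end (increasing⇒upper N s s-inc j l)

      X-inc : Increasing N X
      X-inc j l = circleX-mono (s j) (s (suc j)) (0≤s j (ℕₚ.<⇒≤ l)) (s-inc j l) (s≤1 (suc j) l)
      X-zero : X 0 ≡ 0ℚ
      X-zero = cong circleX s-zero
      X-end : X N ≡ 1ℚ
      X-end = cong circleX s-end
      0≤X : ∀ j → j ℕ.≤ N → 0ℚ ≤ X j
      0≤X j l = subst (_≤ X j) X-zero (increasing⇒lower N X X-inc j l)
      0≤Y : ∀ j → j ℕ.≤ N → 0ℚ ≤ Y j
      0≤Y j l = ≤⇒0≤ (*-monoˡ 2ℚ (nonNegative⁻¹ 2ℚ) (1/1+sq-antitone (0≤s j l) (s≤1 j l)))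

      c-suc : ∀ i → c (suc i) - c i ≡ R
      c-suc i = trans (cong (_- c i) (frac-suc i n)) (solve 2 (λ c r → (c :+ r) :- c := r) refl (c i) R)
      c-inc : Increasing N c
      c-inc i _ = 0≤⇒≤ (subst (0ℚ ≤_) (sym (c-suc i)) (recip≥0 n))
      c-X-zero : c 0 ≡ X 0
      c-X-zero = trans (frac-0 n) (sym X-zero)
      c-X-end : c N ≡ X N
      c-X-end = trans (frac-1 n) (sym X-end)

      -- The functions whose increments are the brackets in `circle-lower` and `circle-upper` when t
      -- - s = R.
      w⁺ w⁻ : ℚ → ℚ
      w⁺ x = ½ * (circleX x * circleY x) + 2ℚ * R * 1/1+sq x
      w⁻ x = ½ * (circleX x * circleY x) - 2ℚ * R * 1/1+sq x

      ∑-along-s : ∀ (w : ℚ → ℚ) → ∑ N (λ j → w (s (suc j)) - w (s j)) ≡ w 1ℚ - w 0ℚ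
      ∑-along-s w = trans (∑-increments N (λ j → w (s j))) (cong₂ (λ a b → w a - w b) s-end s-zero)

      circle-upper-sum : ∑ N (λ j → Y j * (X (suc j) - X j)) ≤ leftSum 1/1+sq s N + R
      circle-upper-sum = ≤-trans
        (∑-mono N λ j l → subst (λ d → Y j * (X (suc j) - X j) ≤ 1/1+sq (s j) * (s (suc j) - s j)
              + ((½ * (X (suc j) * Y (suc j)) - 2ℚ * d * 1/1+sq (s (suc j))) - (½ * (X j * Y j) - 2ℚ * d * 1/1+sq (s j))))
            (uniform-increment 0ℚ R j)
            (circle-upper (s j) (s (suc j)) (0≤s j (ℕₚ.<⇒≤ l)) (s-inc j l) (s≤1 (suc j) l)))
        (≤-reflexive (trans (∑-+ N (λ j → 1/1+sq (s j) * (s (suc j) - s j)) (λ j → w⁻ (s (suc j)) - w⁻ (s j)))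
          (cong (λ z → leftSum 1/1+sq s N + z) (trans (∑-along-s w⁻)
            -- XY vanishes at both ends of the arc, and 1/(1 + s²) falls from 1 to ½, which leaves
            -- 2R · ½ = R.
            (solve 1 (λ r → (con (½ * (circleX 1ℚ * circleY 1ℚ)) :- con 2ℚ :* r :* con (1/1+sq 1ℚ))
                         :- (con (½ * (circleX 0ℚ * circleY 0ℚ)) :- con 2ℚ :* r :* con (1/1+sq 0ℚ)) := r) refl R)))))

      circle-lower-sum : rightSum 1/1+sq s N - R ≤ ∑ N (λ j → Y (suc j) * (X (suc j) - X j))
      circle-lower-sum = ≤-trans
        (≤-reflexive (sym (trans (∑-+ N (λ j → 1/1+sq (s (suc j)) * (s (suc j) - s j)) (λ j → w⁺ (s (suc j)) - w⁺ (s j)))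
          (cong (λ z → rightSum 1/1+sq s N + z) (trans (∑-along-s w⁺)
            (solve 1 (λ r → (con (½ * (circleX 1ℚ * circleY 1ℚ)) :+ con 2ℚ :* r :* con (1/1+sq 1ℚ))
                         :- (con (½ * (circleX 0ℚ * circleY 0ℚ)) :+ con 2ℚ :* r :* con (1/1+sq 0ℚ)) := :- r) refl R))))))
        (∑-mono N λ j l → subst (λ d → 1/1+sq (s (suc j)) * (s (suc j) - s j)
              + ((½ * (X (suc j) * Y (suc j)) + 2ℚ * d * 1/1+sq (s (suc j))) - (½ * (X j * Y j) + 2ℚ * d * 1/1+sq (s j)))
              ≤ Y (suc j) * (X (suc j) - X j))
            (uniform-increment 0ℚ R j)
            (circle-lower (s j) (s (suc j)) (0≤s j (ℕₚ.<⇒≤ l)) (s-inc j l) (s≤1 (suc j) l)))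

      height-zero : h 0 ≡ 1ℚ
      height-zero = trans (cong (λ z → + z / suc n) (isqrt-sq N)) (frac-1 n)
      height-end : h N ≡ 0ℚ
      height-end = trans (cong (λ z → + isqrt z / suc n) (ℕₚ.n∸n≡0 (N ℕ.* N))) (frac-0 n)

      -- The left and right Riemann sums differ by (height at 0 − height at 1)/N = 1/N.
      quarterDisc-right : quarterDisc n ≡ ∑ N (λ i → h (suc i) * (c (suc i) - c i)) + R
      quarterDisc-right = begin
        quarterDisc n                         ≡⟨ solve 2 (λ a b → a := (a :+ b) :- b) refl (quarterDisc n) (∑ N v) ⟩
        (quarterDisc n + ∑ N v) - ∑ N v       ≡⟨ cong₂ _-_ shift (trans (∑-increments N (λ i → h i * R)) (cong₂ (λ a b → a * R - b * R) height-end height-zero)) ⟩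
        A - (0ℚ * R - 1ℚ * R)                 ≡⟨ solve 2 (λ a r → a :- (con 0ℚ :* r :- con 1ℚ :* r) := a :+ r) refl A R ⟩
        A + R                                 ∎
        where
        open ≡-Reasoning
        v : ℕ → ℚ
        v i = h (suc i) * R - h i * R
        A : ℚ
        A = ∑ N (λ i → h (suc i) * (c (suc i) - c i))
        shift : quarterDisc n + ∑ N v ≡ A
        shift = trans (sym (∑-+ N (λ i → h i * R) v)) (∑-cong N λ i _ → trans
          (solve 3 (λ a b r → a :* r :+ (b :* r :- a :* r) := b :* r) refl (h i) (h (suc i)) R)
          (cong (h (suc i) *_) (sym (c-suc i))))

    -- The right sum of the heights lies below the upper sum along the arc. One R pays for passing
    -- to the right sum, the other comes from `circle-upper-sum`.
    quarterDisc≤leftSum : quarterDisc n ≤ leftSum 1/1+sq s N + 2ℚ * R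
    quarterDisc≤leftSum = subst₂ _≤_ (sym quarterDisc-right)
      (solve 2 (λ l r → (l :+ r) :+ r := l :+ con 2ℚ :* r) refl (leftSum 1/1+sq s N) R)
      (+-monoˡ-≤ R (≤-trans
        (step-sum-≤ N N X c Y (λ i → h (suc i)) X-inc c-inc (sym c-X-zero) (sym c-X-end)
          λ j i k l le _ → height-≤ n (suc i) l (circle (s j)) (0≤X j (ℕₚ.<⇒≤ k)) (0≤Y j (ℕₚ.<⇒≤ k)) le)
        circle-upper-sum))

    -- A rounded height may fall short of the arc by R, so the lower sum along the arc is taken with
    -- ordinates Y - R. Over abscissae of total length 1 this costs R; the other R comes from
    -- `circle-lower-sum`.
    rightSum≤quarterDisc : rightSum 1/1+sq s N ≤ quarterDisc n + 2ℚ * R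
    rightSum≤quarterDisc = 0≤⇒≤ {rightSum 1/1+sq s N} {quarterDisc n + 2ℚ * R} (subst (0ℚ ≤_)
        (solve 4 (λ a q r y → (y :- (a :- r)) :+ (q :- (y :- r :* con 1ℚ)) := (q :+ con 2ℚ :* r) :- a) refl
          (rightSum 1/1+sq s N) (quarterDisc n) R (∑ N (λ j → Y (suc j) * (X (suc j) - X j))))
        (0≤+ (≤⇒0≤ circle-lower-sum) (≤⇒0≤ lowered)))
      where
      lowered : ∑ N (λ j → Y (suc j) * (X (suc j) - X j)) - R * 1ℚ ≤ quarterDisc n
      lowered = subst₂ _≤_
        (trans (trans (∑-cong N λ j _ → solve 3 (λ y r x → (y :- r) :* x := y :* x :+ (:- r) :* x) refl (Y (suc j)) R (X (suc j) - X j))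
            (∑-+ N (λ j → Y (suc j) * (X (suc j) - X j)) (λ j → (- R) * (X (suc j) - X j))))
          (cong (λ z → ∑ N (λ j → Y (suc j) * (X (suc j) - X j)) + z)
            (trans (∑-* N (λ j → X (suc j) - X j) (- R))
              (trans (cong ((- R) *_) (trans (∑-increments N X) (cong₂ _-_ X-end X-zero)))
                (solve 1 (λ r → (:- r) :* (con 1ℚ :- con 0ℚ) := :- (r :* con 1ℚ)) refl R)))))
        (∑-cong N λ i _ → cong (h i *_) (c-suc i))
        (step-sum-≤ N N c X h (λ j → Y (suc j) - R) c-inc X-inc c-X-zero c-X-end
          λ i j k l le _ → 0≤⇒≤ {Y (suc j) - R} {h i} (subst (0ℚ ≤_) (solve 3 (λ h r y → (h :+ r) :- y := h :- (y :- r)) refl (h i) R (Y (suc j)))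
            (≤⇒0≤ (height-≥ n i (ℕₚ.<⇒≤ k) (circle (s (suc j))) le))))

  -- The substitution τ

  -- 1/p for p ≥ 1; the maximum only makes the function total.
  inv : ℚ → ℚ
  inv p = (1/ (1ℚ ⊔ p)) {{pos⇒nonZero (1ℚ ⊔ p) {{positive (<-≤-trans (positive⁻¹ 1ℚ) (p≤p⊔q 1ℚ p))}}}}

  inv-inverse : ∀ {p} → 1ℚ ≤ p → inv p * p ≡ 1ℚ
  inv-inverse {p} h = subst (λ z → inv p * z ≡ 1ℚ) (p≤q⇒p⊔q≡q h)
    (*-inverseˡ (1ℚ ⊔ p) {{pos⇒nonZero (1ℚ ⊔ p) {{positive (<-≤-trans (positive⁻¹ 1ℚ) (p≤p⊔q 1ℚ p))}}}})

  0≤inv : ∀ p → 0ℚ ≤ inv p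
  0≤inv p = <⇒≤ (positive⁻¹ (inv p) {{1/pos⇒pos (1ℚ ⊔ p) {{positive (<-≤-trans (positive⁻¹ 1ℚ) (p≤p⊔q 1ℚ p))}}}})

  inv≤1 : ∀ {p} → 1ℚ ≤ p → inv p ≤ 1ℚ
  inv≤1 {p} h = subst₂ _≤_ (*-identityʳ (inv p)) (inv-inverse h) (*-monoˡ (inv p) (0≤inv p) h)

  -- tan(2 arctan p − π/2)
  τ : ℚ → ℚ
  τ p = ½ * (p - inv p)

  1/1+sq-unique : ∀ t {z} → z * (1ℚ + t * t) ≡ 1ℚ → z ≡ 1/1+sq t
  1/1+sq-unique t {z} e = begin
    z                                ≡⟨ sym (*-identityʳ z) ⟩
    z * 1ℚ                           ≡⟨ cong (z *_) (sym (1/1+sq-inverse t)) ⟩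
    z * (1/1+sq t * (1ℚ + t * t))    ≡⟨ solve 3 (λ z f u → z :* (f :* u) := f :* (z :* u)) refl z (1/1+sq t) (1ℚ + t * t) ⟩
    1/1+sq t * (z * (1ℚ + t * t))    ≡⟨ cong (1/1+sq t *_) e ⟩
    1/1+sq t * 1ℚ                    ≡⟨ *-identityʳ (1/1+sq t) ⟩
    1/1+sq t                         ∎
    where open ≡-Reasoning

  -- 1 + τ² = (p + 1/p)²/4 = (1 + p²)²/(4p²).
  1/1+sq-τ : ∀ p → 1ℚ ≤ p → 1/1+sq (τ p) ≡ 2ℚ * 2ℚ * (p * p) * (1/1+sq p * 1/1+sq p)
  1/1+sq-τ p h = sym (1/1+sq-unique (τ p) (begin
    2ℚ * 2ℚ * (p * p) * (f * f) * (1ℚ + τ p * τ p)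
      ≡⟨ solve 3 (λ p f r → con 2ℚ :* con 2ℚ :* (p :* p) :* (f :* f) :* (con 1ℚ :+ (con ½ :* (p :- r)) :* (con ½ :* (p :- r)))
          := f :* f :* (con 2ℚ :* con 2ℚ :* (p :* p) :+ (p :* p :- r :* p) :* (p :* p :- r :* p))) refl p f (inv p) ⟩
    f * f * (2ℚ * 2ℚ * (p * p) + (p * p - inv p * p) * (p * p - inv p * p))
      ≡⟨ cong (λ u → f * f * (2ℚ * 2ℚ * (p * p) + (p * p - u) * (p * p - u))) (inv-inverse h) ⟩
    f * f * (2ℚ * 2ℚ * (p * p) + (p * p - 1ℚ) * (p * p - 1ℚ))
      ≡⟨ solve 2 (λ p f → f :* f :* (con 2ℚ :* con 2ℚ :* (p :* p) :+ (p :* p :- con 1ℚ) :* (p :* p :- con 1ℚ))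
          := (f :* (con 1ℚ :+ p :* p)) :* (f :* (con 1ℚ :+ p :* p))) refl p f ⟩
    (f * (1ℚ + p * p)) * (f * (1ℚ + p * p))
      ≡⟨ cong (λ u → u * u) (1/1+sq-inverse p) ⟩
    1ℚ ∎))
    where
    open ≡-Reasoning
    f : ℚ
    f = 1/1+sq p

  module _ (s t : ℚ) (1≤s : 1ℚ ≤ s) (s≤t : s ≤ t) where
    private
      1≤t : 1ℚ ≤ t
      1≤t = ≤-trans 1≤s s≤t
      f g ρ ρ′ e : ℚ
      f = 1/1+sq s
      g = 1/1+sq t
      ρ = inv s
      ρ′ = inv t
      e = t - s
      0≤e : 0ℚ ≤ e
      0≤e = ≤⇒0≤ s≤t
      0≤2 : 0ℚ ≤ 2ℚ
      0≤2 = nonNegative⁻¹ 2ℚ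

    τ-increment : τ t - τ s ≡ ½ * (e * (1ℚ + ρ * ρ′))
    τ-increment = trans
      -- The factors 1 mark the places where ρ′t and ρs are substituted next.
      (solve 4 (λ s t r q → con ½ :* (t :- q) :- con ½ :* (s :- r) := con ½ :* ((t :- s) :+ (r :* con 1ℚ :- q :* con 1ℚ))) refl s t ρ ρ′)
      (trans (cong₂ (λ u v → ½ * (e + (ρ * u - ρ′ * v))) (sym (inv-inverse 1≤t)) (sym (inv-inverse 1≤s)))
        (solve 4 (λ s t r q → con ½ :* ((t :- s) :+ (r :* (q :* t) :- q :* (r :* s))) := con ½ :* ((t :- s) :* (con 1ℚ :+ r :* q))) refl s t ρ ρ′))

    τ-mono : τ s ≤ τ t
    τ-mono = 0≤⇒≤ {τ s} {τ t} (subst (0ℚ ≤_) (sym τ-increment)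
      (0≤* (nonNegative⁻¹ ½) (0≤* 0≤e (0≤+ (nonNegative⁻¹ 1ℚ) (0≤* (0≤inv s) (0≤inv t))))))

    -- The difference of the two sides is 2f²(t - s)(1 - s/t), written below as 2f²(t - s)²/t.
    τ-upper : 1/1+sq (τ s) * (τ t - τ s) ≤ 2ℚ * (f * (t - s))
    τ-upper = subst (_≤ 2ℚ * (f * e)) (sym (cong₂ _*_ (1/1+sq-τ s 1≤s) τ-increment))
        (0≤⇒≤ {G * D} {2ℚ * (f * e)} (subst (0ℚ ≤_) eq
          (0≤* (0≤* 0≤2 (0≤* 0≤f 0≤e)) (0≤* 0≤f (0≤* (0≤inv t) 0≤e)))))
      where
      0≤f : 0ℚ ≤ f
      0≤f = 1/1+sq≥0 s
      G D : ℚ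
      G = 2ℚ * 2ℚ * (s * s) * (f * f)
      D = ½ * (e * (1ℚ + ρ * ρ′))
      eq : 2ℚ * (f * e) * (f * (ρ′ * e)) ≡ 2ℚ * (f * e) - G * D
      eq = trans (solve 5 (λ s t f r q → con 2ℚ :* (f :* (t :- s)) :* (f :* (q :* (t :- s)))
          := (con 2ℚ :* (f :* (t :- s)) :- con 2ℚ :* con 2ℚ :* (s :* s) :* (f :* f) :* (con ½ :* ((t :- s) :* (con 1ℚ :+ r :* q))))
             :+ (con 2ℚ :* (t :- s) :* (f :* f) :* (q :* t :- con 1ℚ)
               :+ (con 2ℚ :* (t :- s) :* f :* (f :* (con 1ℚ :+ s :* s) :- con 1ℚ)
               :+ con 2ℚ :* (t :- s) :* (f :* f) :* (s :* q) :* (r :* s :- con 1ℚ)))) refl s t f ρ ρ′)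
        (trans (cong₂ (λ u v → (2ℚ * (f * e) - G * D) + (u + v)) (*-excess (2ℚ * e * (f * f)) (inv-inverse 1≤t))
            (cong₂ _+_ (*-excess (2ℚ * e * f) (1/1+sq-inverse s)) (*-excess (2ℚ * e * (f * f) * (s * ρ′)) (inv-inverse 1≤s))))
          (+-identityʳ (2ℚ * (f * e) - G * D)))

    -- The difference of the two sides is 2g²(t - s)(t/s - 1), that is 2g²(t - s)²/s.
    τ-lower : 2ℚ * (g * (t - s)) ≤ 1/1+sq (τ t) * (τ t - τ s)
    τ-lower = subst (2ℚ * (g * e) ≤_) (sym (cong₂ _*_ (1/1+sq-τ t 1≤t) τ-increment))
        (0≤⇒≤ {2ℚ * (g * e)} {G * D} (subst (0ℚ ≤_) eq
          (0≤* (0≤* 0≤2 (0≤* 0≤g 0≤e)) (0≤* 0≤g (0≤* (0≤inv s) 0≤e)))))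
      where
      0≤g : 0ℚ ≤ g
      0≤g = 1/1+sq≥0 t
      G D : ℚ
      G = 2ℚ * 2ℚ * (t * t) * (g * g)
      D = ½ * (e * (1ℚ + ρ * ρ′))
      eq : 2ℚ * (g * e) * (g * (ρ * e)) ≡ G * D - 2ℚ * (g * e)
      eq = trans (solve 5 (λ s t g r q → con 2ℚ :* (g :* (t :- s)) :* (g :* (r :* (t :- s)))
          := (con 2ℚ :* con 2ℚ :* (t :* t) :* (g :* g) :* (con ½ :* ((t :- s) :* (con 1ℚ :+ r :* q))) :- con 2ℚ :* (g :* (t :- s)))
             :- (con 2ℚ :* (t :- s) :* (g :* g) :* (r :* s :- con 1ℚ)
               :+ (con 2ℚ :* (t :- s) :* g :* (g :* (con 1ℚ :+ t :* t) :- con 1ℚ)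
               :+ con 2ℚ :* (t :- s) :* (g :* g) :* (t :* r) :* (q :* t :- con 1ℚ)))) refl s t g ρ ρ′)
        (trans (cong₂ (λ u v → (G * D - 2ℚ * (g * e)) - (u + v)) (*-excess (2ℚ * e * (g * g)) (inv-inverse 1≤s))
            (cong₂ _+_ (*-excess (2ℚ * e * g) (1/1+sq-inverse t)) (*-excess (2ℚ * e * (g * g) * (t * ρ)) (inv-inverse 1≤t))))
          (+-identityʳ (G * D - 2ℚ * (g * e))))

  module _ (p : ℕ → ℚ) (m : ℕ) (inc : Increasing m p) (1≤p : 1ℚ ≤ p 0) where
    private
      1≤ : ∀ j → j ℕ.< m → 1ℚ ≤ p j
      1≤ j l = ≤-trans 1≤p (increasing⇒lower m p inc j (ℕₚ.<⇒≤ l))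

    τ-increasing : Increasing m (λ j → τ (p j))
    τ-increasing j l = τ-mono (p j) (p (suc j)) (1≤ j l) (inc j l)

    leftSum-τ : leftSum 1/1+sq (λ j → τ (p j)) m ≤ 2ℚ * leftSum 1/1+sq p m
    leftSum-τ = subst (leftSum 1/1+sq (λ j → τ (p j)) m ≤_) (∑-* m (λ j → 1/1+sq (p j) * (p (suc j) - p j)) 2ℚ)
      (∑-mono m λ j l → τ-upper (p j) (p (suc j)) (1≤ j l) (inc j l))

    rightSum-τ : 2ℚ * rightSum 1/1+sq p m ≤ rightSum 1/1+sq (λ j → τ (p j)) m
    rightSum-τ = subst (_≤ rightSum 1/1+sq (λ j → τ (p j)) m) (∑-* m (λ j → 1/1+sq (p (suc j)) * (p (suc j) - p j)) 2ℚ)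
      (∑-mono m λ j l → τ-lower (p j) (p (suc j)) (1≤ j l) (inc j l))

  module _ (n : ℕ) (x : ℚ) (1≤x : 1ℚ ≤ x) where
    private
      N : ℕ
      N = suc n
      R e : ℚ
      R = + 1 / suc n
      e = (x - 1ℚ) * R
      s σ : ℕ → ℚ
      s = uniform 0ℚ R
      σ = uniform 1ℚ e
      0≤R : 0ℚ ≤ R
      0≤R = recip≥0 n
      0≤x : 0ℚ ≤ x
      0≤x = ≤-trans (nonNegative⁻¹ 1ℚ) 1≤x
      0≤e : 0ℚ ≤ e
      0≤e = 0≤* (≤⇒0≤ 1≤x) 0≤R

      σ-start : σ 0 ≡ 1ℚ
      σ-start = uniform-zero 1ℚ e
      σ-end : σ N ≡ x
      σ-end = trans (uniform-end 1ℚ (x - 1ℚ) n) (solve 1 (λ x → con 1ℚ :+ (x :- con 1ℚ) := x) refl x)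
      s-end : s N ≡ 1ℚ
      s-end = trans (cong (λ z → 0ℚ + z) (ι*recip n)) (+-identityˡ 1ℚ)
      join : s N ≡ σ 0
      join = trans s-end (sym σ-start)
      s-inc : Increasing N s
      s-inc = uniform-increasing 0ℚ 0≤R N
      σ-inc : Increasing N σ
      σ-inc = uniform-increasing 1ℚ 0≤e N

      τσ-start : τ (σ 0) ≡ 0ℚ
      τσ-start = cong τ σ-start
      τσ-end : τ (σ N) ≡ τ x
      τσ-end = cong τ σ-end
      τσ-inc : Increasing N (λ j → τ (σ j))
      τσ-inc = τ-increasing σ N σ-inc (≤-reflexive (sym σ-start))
      0≤τ : 0ℚ ≤ τ x
      0≤τ = subst₂ _≤_ τσ-start τσ-end (increasing⇒lower N (λ j → τ (σ j)) τσ-inc N ℕₚ.≤-refl)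
      τ≤x : τ x ≤ x
      τ≤x = 0≤⇒≤ {τ x} {x} (subst (0ℚ ≤_) (solve 2 (λ x r → con ½ :* (x :+ r) := x :- con ½ :* (x :- r)) refl x (inv x))
        (0≤* (nonNegative⁻¹ ½) (0≤+ 0≤x (0≤inv x))))

      L₀ U₀ L₁ U₁ a b q : ℚ
      L₀ = rightSum 1/1+sq s N
      U₀ = leftSum 1/1+sq s N
      L₁ = rightSum 1/1+sq σ N
      U₁ = leftSum 1/1+sq σ N
      a = riemann 1/1+sq x n
      b = riemann 1/1+sq (τ x) n
      q = quarterDisc n

      gap : ∀ v d → 0ℚ ≤ d → leftSum 1/1+sq (uniform v d) N ≤ rightSum 1/1+sq (uniform v d) N + d
      gap v d 0≤d = subst (_≤ rightSum 1/1+sq (uniform v d) N + d) (sym (leftSum-rightSum 1/1+sq v d N))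
        (+-monoʳ-≤ (rightSum 1/1+sq (uniform v d) N) (subst ((y - z) * d ≤_) (*-identityˡ d)
          (*-monoʳ {y - z} {1ℚ} d 0≤d (0≤⇒≤ {y - z} {1ℚ} (subst (0ℚ ≤_) (solve 2 (λ y z → (con 1ℚ :- y) :+ z := con 1ℚ :- (y :- z)) refl y z)
            (0≤+ (≤⇒0≤ (1/1+sq≤1 (uniform v d 0))) (1/1+sq≥0 (uniform v d N))))))))
        where
        y z : ℚ
        y = 1/1+sq (uniform v d 0)
        z = 1/1+sq (uniform v d N)

      -- The interval [0, x] is cut at 1. The part [1, x] is the one that τ carries onto [0, τ x] in
      -- the bounds for b.
      a-lower : L₀ + L₁ ≤ a
      a-lower = subst (_≤ a) (∑-concat (λ u v → 1/1+sq v * (v - u)) N N s σ join)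
        (rightSum≤riemann x n 0≤x (concat N s σ) (N ℕ.+ N) (concat-increasing N N s σ join s-inc σ-inc)
          (trans (concat-left N s σ 0 ℕ.z≤n) (uniform-zero 0ℚ R)) (trans (concat-right N s σ join N) σ-end))
      a-upper : a ≤ (U₀ + U₁) + x * R
      a-upper = subst (λ z → a ≤ z + x * R) (∑-concat (λ u v → 1/1+sq u * (v - u)) N N s σ join)
        (riemann≤leftSum x n 0≤x (concat N s σ) (N ℕ.+ N) (concat-increasing N N s σ join s-inc σ-inc)
          (trans (concat-left N s σ 0 ℕ.z≤n) (uniform-zero 0ℚ R)) (trans (concat-right N s σ join N) σ-end))
      b-lower : 2ℚ * L₁ ≤ b
      b-lower = ≤-trans (rightSum-τ σ N σ-inc (≤-reflexive (sym σ-start)))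
        (rightSum≤riemann (τ x) n 0≤τ (λ j → τ (σ j)) N τσ-inc τσ-start τσ-end)
      b-upper : b ≤ 2ℚ * U₁ + x * R
      b-upper = ≤-trans (riemann≤leftSum (τ x) n 0≤τ (λ j → τ (σ j)) N τσ-inc τσ-start τσ-end)
        (+-mono-≤ (leftSum-τ σ N σ-inc (≤-reflexive (sym σ-start))) (*-monoʳ R 0≤R τ≤x))

    -- The quantitative form of 2 arctan x - arctan τ(x) = π/2: in 2a the part over [1, x] cancels
    -- against b, and the part over [0, 1] against 2q.
    riemann-τ : ∣ (2ℚ * a - b) - 2ℚ * q ∣ ≤ 2ℚ * (2ℚ + x + x) * R
    riemann-τ = ∣∣≤
        (0≤⇒≤ {A} {C} (subst (0ℚ ≤_)
          (solve 9 (λ a b q l₀ u₀ l₁ u₁ x r →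
            -- In units of R the errors are 2x from a, 4 from q, and 2 + 2(x - 1) from the gaps
            -- between upper and lower sums: 4x + 4 in all.
            con 2ℚ :* ((u₀ :+ u₁ :+ x :* r) :- a) :+ ((b :- con 2ℚ :* l₁) :+ (con 2ℚ :* ((q :+ con 2ℚ :* r) :- l₀)
              :+ (con 2ℚ :* ((l₀ :+ r) :- u₀) :+ con 2ℚ :* ((l₁ :+ (x :- con 1ℚ) :* r) :- u₁))))
            := con 2ℚ :* (con 2ℚ :+ x :+ x) :* r :- ((con 2ℚ :* a :- b) :- con 2ℚ :* q)) refl a b q L₀ U₀ L₁ U₁ x R)
          (0≤+ (2* a-upper) (0≤+ (≤⇒0≤ b-lower) (0≤+ (2* (rightSum≤quarterDisc n)) gaps)))))
        (0≤⇒≤ { - A} {C} (subst (0ℚ ≤_)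
          (solve 9 (λ a b q l₀ u₀ l₁ u₁ x r →
            -- On this side the errors amount to 3x + 4 only; the separate summand `x :* r` fills up
            -- to the common bound.
            ((con 2ℚ :* u₁ :+ x :* r) :- b) :+ (con 2ℚ :* ((u₀ :+ con 2ℚ :* r) :- q) :+ (con 2ℚ :* (a :- (l₀ :+ l₁))
              :+ (x :* r :+ (con 2ℚ :* ((l₀ :+ r) :- u₀) :+ con 2ℚ :* ((l₁ :+ (x :- con 1ℚ) :* r) :- u₁)))))
            := con 2ℚ :* (con 2ℚ :+ x :+ x) :* r :- (:- ((con 2ℚ :* a :- b) :- con 2ℚ :* q))) refl a b q L₀ U₀ L₁ U₁ x R)
          (0≤+ (≤⇒0≤ b-upper) (0≤+ (2* (quarterDisc≤leftSum n)) (0≤+ (2* a-lower) (0≤+ (0≤* 0≤x 0≤R) gaps))))))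
      where
      A C : ℚ
      A = (2ℚ * a - b) - 2ℚ * q
      C = 2ℚ * (2ℚ + x + x) * R
      2* : ∀ {u v} → u ≤ v → 0ℚ ≤ 2ℚ * (v - u)
      2* h = 0≤* (nonNegative⁻¹ 2ℚ) (≤⇒0≤ h)
      gaps : 0ℚ ≤ 2ℚ * ((L₀ + R) - U₀) + 2ℚ * ((L₁ + e) - U₁)
      gaps = 0≤+ (2* (gap 0ℚ R 0≤R)) (2* (gap 1ℚ e 0≤e))

  -- Powers of the golden mean

  -- Identities between powers of φ hold for an approximant ρ only up to a multiple
  -- of ρ² − ρ − 1; the cofactors are reals, so that they are bounded.
  module GoldenPowers (ρ : ℝ) where

    -- The conjugate of ρ; it satisfies σ² - σ - 1 = ρ² - ρ - 1 exactly, so both have the same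
    -- defect.
    σ : ℝ
    σ = fromℕ 1 -ᴿ ρ

    defect : ℝ
    defect = ρ *ᴿ ρ -ᴿ ρ -ᴿ fromℕ 1

    -- Binet's formula. The powers of ρ and of σ obey the Lucas recurrence up to `defect` times the
    -- power two places below, and these errors accumulate in the cofactor G.
    lucas-sum : ∀ m → Σ ℝ λ G → ∀ n →
      seq (ρ ^ᴿ m) n + seq (σ ^ᴿ m) n - ι (lucas m) ≡ seq defect n * seq G n
    lucas-sum 0 = fromℕ 0 , λ n → sym (*-zeroʳ (seq defect n))
    lucas-sum 1 = fromℕ 0 , λ n → trans
      (solve 1 (λ r → r :* con 1ℚ :+ (con 1ℚ :+ :- r) :* con 1ℚ :- con 1ℚ := con 0ℚ) refl (seq ρ n))
      (sym (*-zeroʳ (seq defect n)))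
    lucas-sum (suc (suc m)) with lucas-sum (suc m) | lucas-sum m
    ... | G₁ , e₁ | G₀ , e₀ = G₁ +ᴿ G₀ +ᴿ (ρ ^ᴿ m +ᴿ σ ^ᴿ m) , λ n →
      let r = seq ρ n
          x = seq (ρ ^ᴿ m) n
          y = seq (σ ^ᴿ m) n
          δ = seq defect n
      in begin
        r * (r * x) + seq σ n * (seq σ n * y) - ι (lucas (suc m) ℕ.+ lucas m)
          ≡⟨ cong (λ z → r * (r * x) + seq σ n * (seq σ n * y) - z) (ι-+ (lucas (suc m)) (lucas m)) ⟩
        r * (r * x) + seq σ n * (seq σ n * y) - (ι (lucas (suc m)) + ι (lucas m))
          ≡⟨ solve 5 (λ r x y l k →
               r :* (r :* x) :+ (con 1ℚ :+ :- r) :* ((con 1ℚ :+ :- r) :* y) :- (l :+ k)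
               := (r :* x :+ (con 1ℚ :+ :- r) :* y :- l) :+ (x :+ y :- k) :+ (r :* r :+ :- r :+ :- con 1ℚ) :* (x :+ y))
               refl r x y (ι (lucas (suc m))) (ι (lucas m)) ⟩
        (r * x + seq σ n * y - ι (lucas (suc m))) + (x + y - ι (lucas m)) + δ * (x + y)
          ≡⟨ cong₂ (λ u v → u + v + δ * (x + y)) (e₁ n) (e₀ n) ⟩
        δ * seq G₁ n + δ * seq G₀ n + δ * (x + y)
          ≡⟨ solve 4 (λ d a b c → d :* a :+ d :* b :+ d :* c := d :* (a :+ b :+ c)) refl δ (seq G₁ n) (seq G₀ n) (x + y) ⟩
        δ * (seq G₁ n + seq G₀ n + (x + y)) ∎
      where
      open ≡-Reasoning

    -- Since ρσ = -(1 + δ) with δ the defect, two further factors of each multiply the product by (1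
    -- + δ)² = 1 + δ(2 + δ).
    odd-power-product : ∀ k → Σ ℝ λ G → ∀ n →
      seq (ρ ^ᴿ (2 ℕ.* k ℕ.+ 1)) n * seq (σ ^ᴿ (2 ℕ.* k ℕ.+ 1)) n + 1ℚ ≡ seq defect n * seq G n
    odd-power-product zero = -ᴿ fromℕ 1 , λ n →
      solve 1 (λ r → (r :* con 1ℚ) :* ((con 1ℚ :+ :- r) :* con 1ℚ) :+ con 1ℚ := (r :* r :+ :- r :+ :- con 1ℚ) :* (:- con 1ℚ)) refl (seq ρ n)
    odd-power-product (suc k) = subst
      (λ j → Σ ℝ λ G → ∀ n → seq (ρ ^ᴿ j) n * seq (σ ^ᴿ j) n + 1ℚ ≡ seq defect n * seq G n)
      (sym (cong (ℕ._+ 1) (ℕₚ.*-suc 2 k)))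
      (step (2 ℕ.* k ℕ.+ 1) (odd-power-product k))
      where
      open ≡-Reasoning
      step : ∀ m → (Σ ℝ λ G → ∀ n → seq (ρ ^ᴿ m) n * seq (σ ^ᴿ m) n + 1ℚ ≡ seq defect n * seq G n) →
        Σ ℝ λ G → ∀ n → seq (ρ ^ᴿ suc (suc m)) n * seq (σ ^ᴿ suc (suc m)) n + 1ℚ ≡ seq defect n * seq G n
      step m (G , e) = G +ᴿ (fromℕ 2 +ᴿ defect) *ᴿ (ρ ^ᴿ m *ᴿ σ ^ᴿ m) , λ n →
        let r = seq ρ n
            x = seq (ρ ^ᴿ m) n
            y = seq (σ ^ᴿ m) n
            δ = seq defect n
        in begin
          (r * (r * x)) * (seq σ n * (seq σ n * y)) + 1ℚ
            ≡⟨ solve 3 (λ r x y → (r :* (r :* x)) :* ((con 1ℚ :+ :- r) :* ((con 1ℚ :+ :- r) :* y)) :+ con 1ℚ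
                 := (x :* y :+ con 1ℚ) :+ (r :* r :+ :- r :+ :- con 1ℚ) :* ((con (ι 2) :+ (r :* r :+ :- r :+ :- con 1ℚ)) :* (x :* y)))
                 refl r x y ⟩
          (x * y + 1ℚ) + δ * ((ι 2 + δ) * (x * y))
            ≡⟨ cong (_+ δ * ((ι 2 + δ) * (x * y))) (e n) ⟩
          δ * seq G n + δ * ((ι 2 + δ) * (x * y))
            ≡⟨ sym (*-distribˡ-+ δ (seq G n) ((ι 2 + δ) * (x * y))) ⟩
          δ * (seq G n + (ι 2 + δ) * (x * y)) ∎

    -- With y the same power of σ, x and y have sum L and product -1 up to the defect, and x² - Lx -
    -- 1 = x(x + y - L) - (xy + 1).
    odd-power-quadratic : ∀ k → Σ ℝ λ G → ∀ n → let x = seq (ρ ^ᴿ (2 ℕ.* k ℕ.+ 1)) n in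
      x * x - ι (lucas (2 ℕ.* k ℕ.+ 1)) * x - 1ℚ ≡ seq defect n * seq G n
    odd-power-quadratic k with lucas-sum (2 ℕ.* k ℕ.+ 1) | odd-power-product k
    ... | G , e | H , h = ρ ^ᴿ m *ᴿ G -ᴿ H , λ n →
      let x = seq (ρ ^ᴿ m) n
          y = seq (σ ^ᴿ m) n
      in trans (solve 3 (λ x y l → x :* x :- l :* x :- con 1ℚ := x :* (x :+ y :- l) :- (x :* y :+ con 1ℚ)) refl x y (ι (lucas m)))
        (trans (cong₂ (λ u v → x * u - v) (e n) (h n))
          (solve 4 (λ x d g h → x :* (d :* g) :- d :* h := d :* (x :* g :+ :- h)) refl x (seq defect n) (seq G n) (seq H n)))
      where
      m : ℕ
      m = 2 ℕ.* k ℕ.+ 1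

  -- The defect of (1 + S)/2 is (S² - 5)/4. It is at most 0, and 5 - S² ≤ 2SR + R² ≤ 7R ≤ 8R.
  half-sum-defect : ∀ S R → 0ℚ ≤ R → R ≤ 1ℚ → S * S ≤ ι 5 → ι 5 ≤ (S + R) * (S + R) → S ≤ ι 3 →
    ∣ ((1ℚ + S) * ½) * ((1ℚ + S) * ½) + - ((1ℚ + S) * ½) + - 1ℚ ∣ ≤ ι 2 * R
  half-sum-defect S R 0≤R R≤1 S²≤5 5≤[S+R]² S≤3 = ∣∣≤
      (0≤⇒≤ {d} {ι 2 * R} (subst (0ℚ ≤_)
        (solve 2 (λ s r → con (½ * ½) :* (con (ι 5) :- s :* s) :+ con (ι 2) :* r
          := con (ι 2) :* r :- (((con 1ℚ :+ s) :* con ½) :* ((con 1ℚ :+ s) :* con ½) :+ :- ((con 1ℚ :+ s) :* con ½) :+ :- con 1ℚ)) refl S R)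
        (0≤+ (0≤* 0≤¼ (≤⇒0≤ S²≤5)) (0≤* (0≤ι 2) 0≤R))))
      (0≤⇒≤ { - d} {ι 2 * R} (subst (0ℚ ≤_)
        (solve 2 (λ s r → con (½ * ½) :* (((s :+ r) :* (s :+ r) :- con (ι 5)) :+ (con (ι 2) :* (r :* (con (ι 3) :- s)) :+ (r :* (con 1ℚ :- r) :+ r)))
          := con (ι 2) :* r :- :- (((con 1ℚ :+ s) :* con ½) :* ((con 1ℚ :+ s) :* con ½) :+ :- ((con 1ℚ :+ s) :* con ½) :+ :- con 1ℚ)) refl S R)
        (0≤* 0≤¼ (0≤+ (≤⇒0≤ 5≤[S+R]²)
          (0≤+ (0≤* (0≤ι 2) (0≤* 0≤R (≤⇒0≤ S≤3))) (0≤+ (0≤* 0≤R (≤⇒0≤ R≤1)) 0≤R))))))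
    where
    d : ℚ
    d = ((1ℚ + S) * ½) * ((1ℚ + S) * ½) + - ((1ℚ + S) * ½) + - 1ℚ
    0≤¼ : 0ℚ ≤ ½ * ½
    0≤¼ = nonNegative⁻¹ (½ * ½)

  module _ (n : ℕ) where
    private
      N h : ℕ
      N = suc n
      h = isqrt (5 ℕ.* (N ℕ.* N))
      R S : ℚ
      R = + 1 / suc n
      S = √seq 5 n
      five : ι (5 ℕ.* (N ℕ.* N)) * (R * R) ≡ ι 5
      five = trans (cong (_* (R * R)) (ι-* 5 (N ℕ.* N))) (trans (*-assoc (ι 5) (ι (N ℕ.* N)) (R * R))
        (trans (cong (ι 5 *_) (scaled-unit n)) (*-identityʳ (ι 5))))
      S²≤5 : S * S ≤ ι 5
      S²≤5 = subst₂ _≤_ (sym (scaled-square h n)) five (*-monoʳ (R * R) (0≤sq R) (ι-mono-≤ (isqrt-lower (5 ℕ.* (N ℕ.* N)))))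
      5≤[S+R]² : ι 5 ≤ (S + R) * (S + R)
      5≤[S+R]² = subst₂ _≤_ five (trans (sym (scaled-square (suc h) n)) (cong (λ z → z * z) (frac-suc h n)))
        (*-monoʳ (R * R) (0≤sq R) (ι-mono-≤ (ℕₚ.<⇒≤ (isqrt-upper (5 ℕ.* (N ℕ.* N))))))
      S≤3 : S ≤ ι 3
      S≤3 = sq-cancel-≤ (0≤ι 3) (≤-trans S²≤5 (ι-mono-≤ {5} {9} (ℕₚ.m≤m+n 5 4)))
      1≤S : 1ℚ ≤ S
      1≤S = subst₂ _≤_ (ι*recip n) (sym (frac h n)) (*-monoʳ R (recip≥0 n) (ι-mono-≤ {N} {h} (isqrt-greatest {N} {5 ℕ.* (N ℕ.* N)} (ℕₚ.m≤n*m (N ℕ.* N) 5))))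
      R≤1 : R ≤ 1ℚ
      R≤1 = subst₂ _≤_ (*-identityˡ R) (ι*recip n) (*-monoʳ R (recip≥0 n) (ι-mono-≤ {1} {N} (ℕ.s≤s ℕ.z≤n)))

    1≤φ : 1ℚ ≤ seq φ n
    1≤φ = *-monoʳ {1ℚ + 1ℚ} {1ℚ + S} ½ (nonNegative⁻¹ ½) (+-monoʳ-≤ 1ℚ 1≤S)

    defect-small : ∣ seq (GoldenPowers.defect φ) n ∣ ≤ ι 2 * R
    defect-small = half-sum-defect S R (recip≥0 n) R≤1 S²≤5 5≤[S+R]² S≤3

    -- Makes `riemann-τ` and `inv-inverse` applicable to the approximant of the power at every
    -- index.
    1≤φ^ : ∀ m → 1ℚ ≤ seq (φ ^ᴿ m) n
    1≤φ^ zero    = ≤-refl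
    1≤φ^ (suc m) = *-mono {1ℚ} {seq φ n} {1ℚ} {seq (φ ^ᴿ m) n} (nonNegative⁻¹ 1ℚ) (≤-trans (nonNegative⁻¹ 1ℚ) 1≤φ) 1≤φ (1≤φ^ m)

  -- Passage to the limit

  -- τ(x) - l/2 = (x² - lx - 1)/(2x), where 1/(2x) ≤ 1.
  τ-near : ∀ x l δ g → 1ℚ ≤ x → x * x - l * x - 1ℚ ≡ δ * g → ∣ τ x - l * ½ ∣ ≤ ∣ δ ∣ * ∣ g ∣
  τ-near x l δ g 1≤x e = begin
    ∣ τ x - l * ½ ∣                            ≡⟨ cong ∣_∣ factor ⟩
    ∣ (δ * g) * (inv x * ½) ∣                  ≤⟨ ∣*∣≤ (δ * g) (inv x * ½) small ⟩
    ∣ δ * g ∣                                  ≡⟨ ∣p*q∣≡∣p∣*∣q∣ δ g ⟩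
    ∣ δ ∣ * ∣ g ∣                              ∎
    where
    open ≤-Reasoning
    factor : τ x - l * ½ ≡ (δ * g) * (inv x * ½)
    factor = trans
      (solve 3 (λ x l r → con ½ :* (x :- r) :- l :* con ½ := ((x :- l) :* con 1ℚ :- r) :* con ½) refl x l (inv x))
      (trans (cong (λ u → ((x - l) * u - inv x) * ½) (sym (inv-inverse 1≤x)))
        (trans (solve 3 (λ x l r → ((x :- l) :* (r :* x) :- r) :* con ½ := (x :* x :- l :* x :- con 1ℚ) :* (r :* con ½)) refl x l (inv x))
          (cong (_* (inv x * ½)) e)))
    0≤half : 0ℚ ≤ inv x * ½
    0≤half = 0≤* (0≤inv x) (nonNegative⁻¹ ½)
    small : ∣ inv x * ½ ∣ ≤ 1ℚ
    small = subst (_≤ 1ℚ) (sym (0≤p⇒∣p∣≡p 0≤half))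
      (≤-trans (*-monoʳ ½ (nonNegative⁻¹ ½) (inv≤1 1≤x)) (≤ᵇ⇒≤ {½} {1ℚ} _))

  arctan-odd-power : ∀ k →
    -ᴿ (π *ᴿ ½ᴿ) ≈ arctan (fromℕ (lucas (2 ℕ.* k ℕ.+ 1)) *ᴿ ½ᴿ) -ᴿ fromℕ 2 *ᴿ arctan (φ ^ᴿ (2 ℕ.* k ℕ.+ 1))
  arctan-odd-power k ε ε>0 =
      let m = 2 ℕ.* k ℕ.+ 1
          G , quadratic = GoldenPowers.odd-power-quadratic φ k
          N₁ , B , _ , x≤B = bounded {seq (φ ^ᴿ m)} (cauchy (φ ^ᴿ m))
          N₂ , K , _ , g≤K = bounded {seq G} (cauchy G)
          -- The first summand is the constant of `riemann-τ` with x replaced by its bound B; the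
          -- second bounds the defect times its cofactor.
          N₃ , small = archimedean (ι 2 * (ι 2 + B + B) + ι 2 * K) ε ε>0
          N₁₂ = N₁ ℕ.⊔ N₂
      in N₁₂ ℕ.⊔ N₃ , λ n l →
        let l₁₂ = ℕₚ.m⊔n≤o⇒m≤o N₁₂ N₃ l in
        ≤-<-trans
          (estimate n (seq (φ ^ᴿ m) n) (ι (lucas m)) (seq (GoldenPowers.defect φ) n) (seq G n) B K (1≤φ^ n m)
            (x≤B n (ℕₚ.m⊔n≤o⇒m≤o N₁ N₂ l₁₂)) (g≤K n (ℕₚ.m⊔n≤o⇒n≤o N₁ N₂ l₁₂)) (defect-small n) (quadratic n))
          (small n (ℕₚ.m⊔n≤o⇒n≤o N₁₂ N₃ l))
    where
    estimate : ∀ n x l δ g B K → 1ℚ ≤ x → ∣ x ∣ ≤ B → ∣ g ∣ ≤ K → ∣ δ ∣ ≤ ι 2 * (+ 1 / suc n) → x * x - l * x - 1ℚ ≡ δ * g →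
      ∣ - ((ι 4 * quarterDisc n) * ½) - (riemann 1/1+sq (l * ½) n + - (ι 2 * riemann 1/1+sq x n)) ∣
        ≤ (ι 2 * (ι 2 + B + B) + ι 2 * K) * (+ 1 / suc n)
    estimate n x l δ g B K 1≤x x≤B g≤K δ≤ e = begin
      ∣ - ((ι 4 * q) * ½) - (c + - (ι 2 * a)) ∣
        -- A rational approximant x has τ(x) only close to l/2, so the Riemann sum b up to τ(x) is
        -- inserted; the Lipschitz bound then moves b to c.
        ≡⟨ cong ∣_∣ (solve 4 (λ a b c q → :- ((con (ι 4) :* q) :* con ½) :- (c :+ :- (con (ι 2) :* a))
             := ((con (ι 2) :* a :- b) :- con (ι 2) :* q) :+ (b :- c)) refl a b c q) ⟩
      ∣ ((ι 2 * a - b) - ι 2 * q) + (b - c) ∣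
        ≤⟨ ∣p+q∣≤∣p∣+∣q∣ ((ι 2 * a - b) - ι 2 * q) (b - c) ⟩
      ∣ (ι 2 * a - b) - ι 2 * q ∣ + ∣ b - c ∣
        ≤⟨ +-mono-≤ (riemann-τ n x 1≤x) (≤-trans (riemann-lipschitz (τ x) (l * ½) n) (τ-near x l (δ) g 1≤x e)) ⟩
      ι 2 * (ι 2 + x + x) * R + ∣ δ ∣ * ∣ g ∣
        ≤⟨ +-mono-≤ (*-monoʳ R (recip≥0 n) (*-monoˡ (ι 2) (0≤ι 2) (+-mono-≤ (+-monoʳ-≤ (ι 2) x≤) x≤)))
             (*-mono {∣ δ ∣} {ι 2 * R} {∣ g ∣} {K} (0≤∣p∣ g) (0≤* (0≤ι 2) (recip≥0 n)) δ≤ g≤K) ⟩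
      ι 2 * (ι 2 + B + B) * R + (ι 2 * R) * K
        ≡⟨ solve 3 (λ b k r → con (ι 2) :* (con (ι 2) :+ b :+ b) :* r :+ (con (ι 2) :* r) :* k
             := (con (ι 2) :* (con (ι 2) :+ b :+ b) :+ con (ι 2) :* k) :* r) refl B K R ⟩
      (ι 2 * (ι 2 + B + B) + ι 2 * K) * R ∎
      where
      open ≤-Reasoning
      R q a b c : ℚ
      R = + 1 / suc n
      q = quarterDisc n
      a = riemann 1/1+sq x n
      b = riemann 1/1+sq (τ x) n
      c = riemann 1/1+sq (l * ½) n
      x≤ : x ≤ B
      x≤ = ≤-trans (p≤∣p∣ x) x≤B

open import Data.Nat using (_+_; _*_)

mainTheorem6 : (k : ℕ) →
    -ᴿ (π *ᴿ ½ᴿ) ≈ arctan (fromℕ (lucas (2 * k + 1)) *ᴿ ½ᴿ) -ᴿ fromℕ 2 *ᴿ arctan (φ ^ᴿ (2 * k + 1))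
mainTheorem6 = Estimates.arctan-odd-power
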